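{- Let $n\ge 1$ and $m\ge 2$, and let $\lambda=(n,\dots,n)$ be the $m$-row rectangular shape ($m$ rows of length $n$). Let $M_\lambda=nT_{m-1}=n\binom{m}{2}$ be the maximum inversion number for shape $\lambda$. Then $|S_{M_\lambda-1}(\lambda)|=mn-1$.
   Context: A tableau of shape $\lambda$ is a bijective filling of the $m\times n$ array with $1,\dots,mn$; it is row-standard if entries increase left to right along each row. For a row-standard tableau $\tau$, a pair of entries $i<j$ in the same column is an inversion if either (1) $i$ or $j$ has no entry immediately to its right and $i$ lies below $j$, or (2) $i$ is immediately followed on its right by $i'$, $j$ is immediately followed on its right by $j'$, and $i'>j'$. $S_i(\lambda)$ is the set of row-standard tableaux of shape $\lambda$ with exactly $i$ inversions. $T_k=k(k+1)/2$ denotes the $k$-th triangular number. -}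

module Defs where

open import Data.Nat using (ℕ; zero; suc; _+_; _*_; _∸_; _<ᵇ_; _≡ᵇ_)
open import Data.Bool using (Bool; true; false; _∧_; _∨_; not; if_then_else_; T)
open import Data.Fin using (Fin; toℕ; _≟_; zero; suc)
open import Data.Maybe using (Maybe; just; nothing)
import Data.Maybe
open import Data.Bool.Properties using (T?)
open import Data.Vec using (Vec; lookup)
open import Data.List using (List; allFin; length; filter; all; any; map; concat)
open import Data.Product using (Σ; _×_; _,_)
open import Relation.Nullary.Decidable using (does)

triangular : ℕ → ℕ
triangular zero = zero
triangular (suc k) = suc k + triangular k

-- A filling of the m × n array (m rows, each of length n) with values in
-- Fin (m * n); the value v stands for the entry v+1, so the entries
-- 1,…,mn of the paper correspond to 0,…,mn-1 (order preserved).
-- Row i (0 = top row), column j (0 = leftmost).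
Filling : ℕ → ℕ → Set
Filling m n = Vec (Vec (Fin (m * n)) n) m

entry : ∀ {m n} → Filling m n → Fin m → Fin n → Fin (m * n)
entry t i j = lookup (lookup t i) j

_<F_ : ∀ {k} → Fin k → Fin k → Bool
a <F b = toℕ a <ᵇ toℕ b

_==F_ : ∀ {k} → Fin k → Fin k → Bool
a ==F b = does (a ≟ b)

positions : (m n : ℕ) → List (Fin m × Fin n)
positions m n = concat (map (λ i → map (λ j → (i , j)) (allFin n)) (allFin m))

isInjective : ∀ {m n} → Filling m n → Bool
isInjective {m} {n} t =
  all (λ { (i , j) → all (λ { (i' , j') →
        not (entry t i j ==F entry t i' j') ∨ ((i ==F i') ∧ (j ==F j')) })
      (positions m n) }) (positions m n)

isSurjective : ∀ {m n} → Filling m n → Bool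
isSurjective {m} {n} t =
  all (λ v → any (λ { (i , j) → entry t i j ==F v }) (positions m n))
      (allFin (m * n))

isTableau : ∀ {m n} → Filling m n → Bool
isTableau t = isInjective t ∧ isSurjective t

isRowStandard : ∀ {m n} → Filling m n → Bool
isRowStandard {m} {n} t =
  all (λ i → all (λ j → all (λ j' →
        not (j <F j') ∨ (entry t i j <F entry t i j'))
      (allFin n)) (allFin n)) (allFin m)

-- Is the pair of entries a = entry (r₁,c) < b = entry (r₂,c) (same column c)
-- an inversion?  Column c is the last column (c = n-1) iff neither entry
-- has an entry immediately to its right (the shape is a rectangle).
--  (1) last column: inversion iff a lies below b, i.e. r₁ is a lower row (r₂ < r₁);
--  (2) otherwise: with a' = entry (r₁,c+1), b' = entry (r₂,c+1), inversion iff a' > b'.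
-- the column immediately to the right of column c, if any
nextCol : ∀ {n} → Fin n → Maybe (Fin n)
nextCol {suc zero} zero = nothing
nextCol {suc (suc n)} zero = just (suc zero)
nextCol {suc (suc n)} (suc c) = Data.Maybe.map suc (nextCol c)

isInversionAt : ∀ {m n} → Filling m n → Fin n → Fin m → Fin m → Bool
isInversionAt t c r₁ r₂ with nextCol c
... | nothing = (entry t r₁ c <F entry t r₂ c) ∧ (r₂ <F r₁)
... | just c' = (entry t r₁ c <F entry t r₂ c) ∧ (entry t r₂ c' <F entry t r₁ c')

-- number of inversions: number of triples (c, r₁, r₂) with
-- entry (r₁,c) < entry (r₂,c) forming an inversion (each unordered pair
-- of entries in a column is counted once, oriented by value).
inversions : ∀ {m n} → Filling m n → ℕ
inversions {m} {n} t =
  length (filter (λ { (c , r₁ , r₂) → T? (isInversionAt t c r₁ r₂) })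
    (concat (map (λ c → concat (map (λ r₁ → map (λ r₂ → (c , r₁ , r₂))
        (allFin m)) (allFin m))) (allFin n))))

inS : (m n i : ℕ) → Filling m n → Bool
inS m n i t = isTableau t ∧ isRowStandard t ∧ (inversions t ≡ᵇ i)

S : (m n i : ℕ) → Set
S m n i = Σ (Filling m n) (λ t → T (inS m n i t))

{-# OPTIONS --safe #-}
module Submission where

open import Defs
open import Data.Nat using (ℕ; _*_; _∸_; _≤_)
open import Data.Fin using (Fin)
open import Function.Bundles using (_↔_)

import Data.Nat.Properties as ℕ
open import Algebra.Properties.CommutativeMonoid.Sum ℕ.+-0-commutativeMonoid
  using (sum; sum-cong-≗; ∑-distrib-+)
open import Data.Bool using (Bool; true; false; _∧_; _∨_; not; T)
open import Data.Bool.ListAction using (all)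
open import Data.Bool.Properties using (T-∧; T-irrelevant)
open import Data.Empty using (⊥; ⊥-elim)
open import Data.Fin as Fin using (zero; suc; toℕ; fromℕ; fromℕ<; inject₁; opposite; combine; cast)
  renaming (_<_ to _<ᶠ_)
import Data.Fin.Induction as Fin
import Data.Fin.Properties as Fin
open import Data.Fin.Relation.Unary.Top using (view; ‵fromℕ; ‵inject₁)
open import Data.List using (List; _++_; allFin; length; filter; concat; map; tabulate)
import Data.List.Properties as List
open import Data.List.Membership.Propositional using (_∈_; lose; find)
open import Data.List.Membership.Propositional.Properties using (∈-map⁺; ∈-concat⁺′; ∈-allFin)
import Data.List.Relation.Unary.All as All
import Data.List.Relation.Unary.All.Properties as All
import Data.List.Relation.Unary.Any.Properties as Any
open import Data.Maybe using (Maybe; just; nothing)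
open import Data.Nat as ℕ using (zero; suc; _+_; _<_; _<ᵇ_; z≤n; s≤s)
open import Data.Product using (∃; ∃-syntax; _×_; _,_; proj₁; proj₂; map₂)
open import Data.Sum as Sum using (_⊎_; inj₁; inj₂)
open import Data.Vec using (lookup)
import Data.Vec as Vec
import Data.Vec.Properties as Vec
open import Function using (_∘_; id; Equivalence; mk↔ₛ′)
open import Induction.WellFounded using (Acc; acc)
open import Relation.Binary.Definitions using (tri<; tri≈; tri>)
open import Relation.Binary.PropositionalEquality
open import Relation.Nullary using (¬_; Dec; yes; no; does; contradiction)
open import Relation.Unary using (Decidable)

open Equivalence using (to; from)

-- Give every row r a virtual entry mn + r in an extra last column.  Then
-- both clauses of the definition say that a pair of rows inverts at column c
-- when columns c and c + 1 order it oppositely.  A column contributes T_{m-1}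
-- ordered pairs, so a tableau with M - 1 inversions has exactly one "defect":
-- a column c₀ and rows a, b with a below b in value both at c₀ and at c₀ + 1.
--
-- Starting from the virtual column and moving left, the order of every column
-- is forced: it is reversed at each step, except that at c₀ the rows a and b,
-- which must be adjacent in rank (say ranks i and i + 1), keep their order.
-- Moreover every entry of column c is smaller than every entry of column
-- c + 1, with the possible exception of (b , c₀) against (a , c₀ + 1), which
-- can be out of order only if b has the top rank.  So the tableau is determined
-- by k + 1, the (0-based) value of its entry at (b , c₀): writing
-- k = m c₀ + j with 0 ≤ j < m, the case j < m - 1 is the regular one with
-- i = j, and j = m - 1 is the exceptional one with i = m - 2.  Here k ranges
-- over 0, …, mn - 2.

private variable
  k l : ℕ

-- Adjacent transpositions and order-preserving maps of Fin

swap : Fin k → Fin (suc k) → Fin (suc k)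
swap zero    zero          = suc zero
swap zero    (suc zero)    = zero
swap zero    (suc (suc x)) = suc (suc x)
swap (suc i) zero          = zero
swap (suc i) (suc x)       = suc (swap i x)

swap-involutive : (i : Fin k) (x : Fin (suc k)) → swap i (swap i x) ≡ x
swap-involutive zero    zero          = refl
swap-involutive zero    (suc zero)    = refl
swap-involutive zero    (suc (suc x)) = refl
swap-involutive (suc i) zero          = refl
swap-involutive (suc i) (suc x)       = cong suc (swap-involutive i x)

swap-inject₁ : (i : Fin k) → swap i (inject₁ i) ≡ suc i
swap-inject₁ zero    = refl
swap-inject₁ (suc i) = cong suc (swap-inject₁ i)

swap-suc : (i : Fin k) → swap i (suc i) ≡ inject₁ i
swap-suc zero    = refl
swap-suc (suc i) = cong suc (swap-suc i)

-- No value lies strictly between i and i + 1, so exchanging these two leaves every other comparison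
-- as it was.
swap-mono-< : (i : Fin k) {x y : Fin (suc k)} → x <ᶠ y →
              swap i x <ᶠ swap i y ⊎ (x ≡ inject₁ i × y ≡ suc i)
swap-mono-< zero    {zero}        {suc zero}    _ = inj₂ (refl , refl)
swap-mono-< zero    {zero}        {suc (suc y)} _ = inj₁ (s≤s (s≤s z≤n))
swap-mono-< zero    {suc zero}    {suc zero}    (s≤s ())
swap-mono-< zero    {suc zero}    {suc (suc y)} _ = inj₁ (s≤s z≤n)
swap-mono-< zero    {suc (suc x)} {suc zero}    (s≤s ())
swap-mono-< zero    {suc (suc x)} {suc (suc y)} p = inj₁ p
swap-mono-< (suc i) {zero}        {suc y}       _ = inj₁ (s≤s z≤n)
swap-mono-< (suc i) {suc x}       {suc y} (s≤s p) with swap-mono-< i p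
... | inj₁ q            = inj₁ (s≤s q)
... | inj₂ (refl , refl) = inj₂ (refl , refl)

opposite-anti-< : {x y : Fin l} → x <ᶠ y → opposite y <ᶠ opposite x
opposite-anti-< {l} {x} {y} x<y
  rewrite Fin.opposite-prop x | Fin.opposite-prop y = ℕ.∸-monoʳ-< (s≤s x<y) (Fin.toℕ<n y)

opposite-cancel-< : {x y : Fin l} → opposite x <ᶠ opposite y → y <ᶠ x
opposite-cancel-< {x = x} {y} p =
  subst₂ _<ᶠ_ (Fin.opposite-involutive y) (Fin.opposite-involutive x) (opposite-anti-< p)

-- The ranking of the rows d columns to the left of the virtual one, as long as no defect
-- intervenes.
flips : ℕ → Fin l → Fin l
flips zero    x = x
flips (suc d) x = opposite (flips d x)

flips-opposite : ∀ d (x : Fin l) → flips d (opposite x) ≡ opposite (flips d x)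
flips-opposite zero    x = refl
flips-opposite (suc d) x = cong opposite (flips-opposite d x)

flips-involutive : ∀ d (x : Fin l) → flips d (flips d x) ≡ x
flips-involutive zero    x = refl
flips-involutive (suc d) x = begin
  opposite (flips d (opposite (flips d x))) ≡⟨ cong opposite (flips-opposite d _) ⟩
  opposite (opposite (flips d (flips d x))) ≡⟨ Fin.opposite-involutive _ ⟩
  flips d (flips d x)                       ≡⟨ flips-involutive d x ⟩
  x                                         ∎
  where open ≡-Reasoning

-- If h x < x, iterating h gives an infinite descent x > h x > h (h x) > ...; if h x > x, it gives
-- an infinite ascent. `Fin l` admits neither.
strictlyMonotone⇒id : (h : Fin l → Fin l) → (∀ {x y} → x <ᶠ y → h x <ᶠ h y) → ∀ x → h x ≡ x
strictlyMonotone⇒id h mono x with Fin.<-cmp (h x) x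
... | tri≈ _ eq _ = eq
... | tri< lt _ _ = ⊥-elim (not-below (Fin.<-wellFounded x) lt)
  where
  not-below : ∀ {x} → Acc _<ᶠ_ x → ¬ (h x <ᶠ x)
  not-below (acc rec) lt = not-below (rec lt) (mono lt)
... | tri> _ _ gt = ⊥-elim (not-above (Fin.>-wellFounded x) gt)
  where
  not-above : ∀ {x} → Acc Fin._>_ x → ¬ (x <ᶠ h x)
  not-above (acc rec) lt = not-above (rec lt) (mono lt)

-- `g` after the inverse of `f` is a strictly monotone self-map of `Fin l`, hence the identity. So a
-- tableau can be identified with its model by comparing the order of cells only.
orderPreserving⇒≗ : {A : Set} (f g : A → Fin l) → (∀ v → ∃[ p ] f p ≡ v) →
                    (∀ p q → f p <ᶠ f q → g p <ᶠ g q) → (∀ p q → f p ≡ f q → p ≡ q) →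
                    ∀ p → f p ≡ g p
orderPreserving⇒≗ f g surj mono inj p = sym (begin
  g p                     ≡⟨ cong g (inj _ _ (proj₂ (surj (f p)))) ⟨
  g (proj₁ (surj (f p)))  ≡⟨ strictlyMonotone⇒id (g ∘ proj₁ ∘ surj) h-mono (f p) ⟩
  f p                     ∎)
  where
  open ≡-Reasoning
  h-mono : ∀ {x y} → x <ᶠ y → g (proj₁ (surj x)) <ᶠ g (proj₁ (surj y))
  h-mono {x} {y} x<y = mono _ _ (subst₂ _<ᶠ_ (sym (proj₂ (surj x))) (sym (proj₂ (surj y))) x<y)

inject₁≢suc : (i : Fin l) → inject₁ i ≢ suc i
inject₁≢suc zero    ()
inject₁≢suc (suc i) eq = inject₁≢suc i (Fin.suc-injective eq)

inject₁<suc : (i : Fin l) → inject₁ i <ᶠ suc i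
inject₁<suc i = s≤s (ℕ.≤-reflexive (Fin.toℕ-inject₁ i))

at : ∀ {c} → c < l → ∃[ x ] toℕ {l} x ≡ c
at c<n = fromℕ< c<n , Fin.toℕ-fromℕ< c<n

x<y⇒inject₁ : {x y : Fin (suc l)} → x <ᶠ y → ∃[ j ] inject₁ j ≡ x
x<y⇒inject₁ {x = x} {y} x<y with view x
... | ‵inject₁ j = j , refl
... | ‵fromℕ     = contradiction (subst (_< toℕ y) (Fin.toℕ-fromℕ _) x<y) (ℕ.≤⇒≯ (Fin.toℕ≤pred[n] y))

-- Since y lies above x, x has a successor; it cannot exceed y, and if it were below y it would lie
-- in the gap.
consecutive : {x y : Fin (suc l)} → x <ᶠ y → (∀ z → x <ᶠ z → z <ᶠ y → ⊥) →
              ∃[ i ] x ≡ inject₁ i × y ≡ suc i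
consecutive {x = x} {y} x<y gap with i , refl ← x<y⇒inject₁ x<y with Fin.<-cmp (suc i) y
... | tri< lt _ _ = ⊥-elim (gap (suc i) (inject₁<suc i) lt)
... | tri≈ _ eq _ = i , refl , sym eq
... | tri> _ _ gt = contradiction (ℕ.<-≤-trans x<y (ℕ.s≤s⁻¹ gt)) (ℕ.<-irrefl (Fin.toℕ-inject₁ i))

-- Positions beyond the virtual one (index l) also hold d; they are never used.
extend : (Fin l → ℕ) → ℕ → ℕ → ℕ
extend {zero}  g d c       = d
extend {suc l} g d zero    = g zero
extend {suc l} g d (suc c) = extend (g ∘ suc) d c

extend-toℕ : (g : Fin l → ℕ) (d : ℕ) (c : Fin l) → extend g d (toℕ c) ≡ g c
extend-toℕ g d zero    = refl
extend-toℕ g d (suc c) = extend-toℕ (g ∘ suc) d c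

extend-end : (g : Fin l → ℕ) (d : ℕ) → extend g d l ≡ d
extend-end {zero}  g d = refl
extend-end {suc l} g d = extend-end (g ∘ suc) d

extend-cong : ∀ {g h : Fin l → ℕ} d → (∀ c → g c ≡ h c) → ∀ c → extend g d c ≡ extend h d c
extend-cong {zero}  d eq c       = refl
extend-cong {suc l} d eq zero    = eq zero
extend-cong {suc l} d eq (suc c) = extend-cong d (eq ∘ suc) c

-- Counting by sums of indicators

⟦_⟧ : Bool → ℕ
⟦ true ⟧  = 1
⟦ false ⟧ = 0

module _ {A : Set} {P : A → Set} (P? : Decidable P) where

  length-filter-concat : (f : Fin l → List A) →
    length (filter P? (concat (map f (allFin l)))) ≡ sum (λ i → length (filter P? (f i)))
  length-filter-concat f = trans (cong (length ∘ filter P? ∘ concat) (List.map-tabulate id f)) (go f)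
    where
    go : ∀ {l} (f : Fin l → List A) →
         length (filter P? (concat (tabulate f))) ≡ sum (λ i → length (filter P? (f i)))
    go {zero}  f = refl
    go {suc l} f = begin
      length (filter P? (f zero ++ concat (tabulate (f ∘ suc))))
        ≡⟨ cong length (List.filter-++ P? (f zero) _) ⟩
      length (filter P? (f zero) ++ filter P? (concat (tabulate (f ∘ suc))))
        ≡⟨ List.length-++ (filter P? (f zero)) ⟩
      length (filter P? (f zero)) + length (filter P? (concat (tabulate (f ∘ suc))))
        ≡⟨ cong (length (filter P? (f zero)) +_) (go (f ∘ suc)) ⟩
      length (filter P? (f zero)) + sum (λ i → length (filter P? (f (suc i)))) ∎
      where open ≡-Reasoning

  length-filter-map : (g : Fin l → A) →
    length (filter P? (map g (allFin l))) ≡ sum (λ i → ⟦ does (P? (g i)) ⟧)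
  length-filter-map g = trans (cong (length ∘ filter P?) (List.map-tabulate id g)) (go g)
    where
    go : ∀ {l} (g : Fin l → A) → length (filter P? (tabulate g)) ≡ sum (λ i → ⟦ does (P? (g i)) ⟧)
    go {zero}  g = refl
    go {suc l} g with does (P? (g zero))
    ... | true  = cong suc (go (g ∘ suc))
    ... | false = go (g ∘ suc)

length-filter-triples : ∀ {m n} {P : Fin n × Fin m × Fin m → Set} (P? : Decidable P) →
  length (filter P? (concat (map (λ c → concat (map (λ r → map (λ r′ → (c , r , r′))
    (allFin m)) (allFin m))) (allFin n)))) ≡
  sum {n} (λ c → sum {m} (λ r → sum {m} (λ r′ → ⟦ does (P? (c , r , r′)) ⟧)))
length-filter-triples {m} {n} P? =
  trans (length-filter-concat P? (λ c → concat (map (λ r → map (λ r′ → (c , r , r′)) (allFin m)) (allFin m))))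
    (sum-cong-≗ {n} λ c → trans (length-filter-concat P? (λ r → map (λ r′ → (c , r , r′)) (allFin m)))
      (sum-cong-≗ {m} λ r → length-filter-map P? (λ r′ → (c , r , r′))))

inversions≡sum : ∀ {m n} (t : Filling m n) →
  inversions t ≡ sum {n} (λ c → sum {m} (λ r → sum {m} (λ r′ → ⟦ isInversionAt t c r r′ ⟧)))
inversions≡sum {m} {n} t = length-filter-triples {m} {n} _

sum-const : ∀ n x → sum {n} (λ _ → x) ≡ n * x
sum-const zero    x = refl
sum-const (suc n) x = cong (x +_) (sum-const n x)

sum≡0⇒ : (f : Fin l → ℕ) → sum f ≡ 0 → ∀ i → f i ≡ 0
sum≡0⇒ f eq zero    = ℕ.m+n≡0⇒m≡0 (f zero) eq
sum≡0⇒ f eq (suc i) = sum≡0⇒ (f ∘ suc) (ℕ.m+n≡0⇒n≡0 (f zero) eq) i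

sum≡0⇐ : (f : Fin l → ℕ) → (∀ i → f i ≡ 0) → sum f ≡ 0
sum≡0⇐ {zero}  f eq = refl
sum≡0⇐ {suc l} f eq = cong₂ _+_ (eq zero) (sum≡0⇐ (f ∘ suc) (eq ∘ suc))

sum≡1⇒ : (f : Fin l → ℕ) → sum f ≡ 1 → ∃[ i ] f i ≡ 1 × (∀ j → f j ≡ 0 ⊎ j ≡ i)
sum≡1⇒ {suc l} f eq with f zero in eq₀
... | suc zero = zero , eq₀ , λ where
  zero    → inj₂ refl
  (suc j) → inj₁ (sum≡0⇒ (f ∘ suc) (ℕ.suc-injective eq) j)
... | zero with i , fi , rest ← sum≡1⇒ (f ∘ suc) eq = suc i , fi , λ where
  zero    → inj₁ eq₀
  (suc j) → Sum.map₂ (cong suc) (rest j)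

sum≡1⇐ : (f : Fin l) (g : Fin l → ℕ) → g f ≡ 1 → (∀ j → g j ≡ 0 ⊎ j ≡ f) → sum g ≡ 1
sum≡1⇐ zero    g eq rest = cong₂ _+_ eq (sum≡0⇐ (g ∘ suc) λ j → zero-at (rest (suc j)))
  where
  zero-at : ∀ {j} → g (suc j) ≡ 0 ⊎ suc j ≡ zero → g (suc j) ≡ 0
  zero-at (inj₁ eq) = eq
sum≡1⇐ (suc i) g eq rest = cong₂ _+_ (zero-at (rest zero))
  (sum≡1⇐ i (g ∘ suc) eq λ j → Sum.map₂ Fin.suc-injective (rest (suc j)))
  where
  zero-at : g zero ≡ 0 ⊎ zero ≡ suc i → g zero ≡ 0
  zero-at (inj₁ eq) = eq

sum₃ : ∀ {k l m} → (Fin k → Fin l → Fin m → ℕ) → ℕ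
sum₃ x = sum λ c → sum λ r → sum (x c r)

-- Naturals adding up to 1 have exactly one nonzero term. Using this for the column, the first row
-- and the second row in turn locates the single defect.
sum₃≡1⇒ : ∀ {k l m} (x : Fin k → Fin l → Fin m → ℕ) → sum₃ x ≡ 1 →
          ∃[ c ] ∃[ a ] ∃[ b ] x c a b ≡ 1 × (∀ c′ r r′ → x c′ r r′ ≡ 0 ⊎ (c′ ≡ c × r ≡ a × r′ ≡ b))
sum₃≡1⇒ x eq
  with c , eq , restᶜ ← sum≡1⇒ _ eq
  with a , eq , restᵃ ← sum≡1⇒ _ eq
  with b , eq , restᵇ ← sum≡1⇒ _ eq = c , a , b , eq , rest
  where
  rest : ∀ c′ r r′ → x c′ r r′ ≡ 0 ⊎ (c′ ≡ c × r ≡ a × r′ ≡ b)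
  rest c′ r r′ with restᶜ c′
  ... | inj₁ eq = inj₁ (sum≡0⇒ _ (sum≡0⇒ _ eq r) r′)
  ... | inj₂ refl with restᵃ r
  ...   | inj₁ eq = inj₁ (sum≡0⇒ _ eq r′)
  ...   | inj₂ refl with restᵇ r′
  ...     | inj₁ eq   = inj₁ eq
  ...     | inj₂ refl = inj₂ (refl , refl , refl)

sum₃≡1⇐ : ∀ {k l m} (x : Fin k → Fin l → Fin m → ℕ) {c a b} → x c a b ≡ 1 →
          (∀ c′ r r′ → x c′ r r′ ≡ 0 ⊎ (c′ ≡ c × r ≡ a × r′ ≡ b)) → sum₃ x ≡ 1
sum₃≡1⇐ x {c} {a} {b} eq rest =
  sum≡1⇐ c _ (sum≡1⇐ a _ (sum≡1⇐ b _ eq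
    (λ r′ → Sum.map₂ (proj₂ ∘ proj₂) (rest c a r′)))
    (λ r → vanish (r Fin.≟ a) λ r≢a → sum≡0⇐ _ λ r′ → off (rest c r r′) (r≢a ∘ proj₁ ∘ proj₂)))
    (λ c′ → vanish (c′ Fin.≟ c) λ c′≢c → sum≡0⇐ _ λ r → sum≡0⇐ _ λ r′ → off (rest c′ r r′) (c′≢c ∘ proj₁))
  where
  vanish : ∀ {A B : Set} → Dec A → (¬ A → B) → B ⊎ A
  vanish (yes a) _ = inj₂ a
  vanish (no ¬a) f = inj₁ (f ¬a)
  off : ∀ {A B : Set} → A ⊎ B → ¬ B → A
  off (inj₁ a) _ = a
  off (inj₂ b) ¬b = contradiction b ¬b

<ᵇ-irrefl : ∀ x → ⟦ x <ᵇ x ⟧ ≡ 0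
<ᵇ-irrefl zero    = refl
<ᵇ-irrefl (suc x) = <ᵇ-irrefl x

<ᵇ-connex : ∀ x y → x ≢ y → ⟦ x <ᵇ y ⟧ + ⟦ y <ᵇ x ⟧ ≡ 1
<ᵇ-connex zero    zero    x≢y = contradiction refl x≢y
<ᵇ-connex zero    (suc y) x≢y = refl
<ᵇ-connex (suc x) zero    x≢y = refl
<ᵇ-connex (suc x) (suc y) x≢y = <ᵇ-connex x y (x≢y ∘ cong suc)

-- Two distinct values ascend in exactly one direction, so each unordered pair of rows counts once.
-- In the induction the first row meets the `suc k` others, which is `A+B`.
count-ascents : ∀ k (e : Fin (suc k) → ℕ) → (∀ {r r′} → e r ≡ e r′ → r ≡ r′) →
                sum (λ r → sum (λ r′ → ⟦ e r <ᵇ e r′ ⟧)) ≡ triangular k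
count-ascents zero e inj rewrite <ᵇ-irrefl (e zero) = refl
count-ascents (suc k) e inj = begin
  ⟦ e zero <ᵇ e zero ⟧ + A + sum (λ r → ⟦ e (suc r) <ᵇ e zero ⟧ + C r)
    ≡⟨ cong₂ _+_ (cong (_+ A) (<ᵇ-irrefl (e zero))) (∑-distrib-+ (λ r → ⟦ e (suc r) <ᵇ e zero ⟧) C) ⟩
  A + (B + sum C)
    ≡⟨ ℕ.+-assoc A B _ ⟨
  A + B + sum C
    ≡⟨ cong₂ _+_ A+B (count-ascents k (e ∘ suc) (Fin.suc-injective ∘ inj)) ⟩
  suc k + triangular k ∎
  where
  open ≡-Reasoning
  C : Fin (suc k) → ℕ
  C r = sum (λ r′ → ⟦ e (suc r) <ᵇ e (suc r′) ⟧)
  A B : ℕ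
  A = sum (λ r → ⟦ e zero <ᵇ e (suc r) ⟧)
  B = sum (λ r → ⟦ e (suc r) <ᵇ e zero ⟧)
  A+B : A + B ≡ suc k
  A+B = begin
    A + B ≡⟨ ∑-distrib-+ (λ r → ⟦ e zero <ᵇ e (suc r) ⟧) (λ r → ⟦ e (suc r) <ᵇ e zero ⟧) ⟨
    sum (λ r → ⟦ e zero <ᵇ e (suc r) ⟧ + ⟦ e (suc r) <ᵇ e zero ⟧)
          ≡⟨ sum-cong-≗ (λ r → <ᵇ-connex (e zero) (e (suc r)) (Fin.0≢1+n ∘ inj)) ⟩
    sum {suc k} (λ _ → 1) ≡⟨ sum-const (suc k) 1 ⟩
    suc k * 1             ≡⟨ ℕ.*-identityʳ (suc k) ⟩
    suc k                 ∎

-- Reflecting the Boolean predicates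

all⇒ : ∀ {A : Set} {P : A → Bool} xs → T (all P xs) → ∀ {x} → x ∈ xs → T (P x)
all⇒ {P = P} xs h = All.lookup (All.all⁺ P xs h)

all⇐ : ∀ {A : Set} {P : A → Bool} xs → (∀ x → T (P x)) → T (all P xs)
all⇐ {P = P} xs h = All.all⁻ P {xs = xs} (All.tabulate (λ {x} _ → h x))

does⇒ : ∀ {A : Set} (A? : Dec A) → T (does A?) → A
does⇒ (yes a) _ = a

does⇐ : ∀ {A : Set} (A? : Dec A) → A → T (does A?)
does⇐ (yes _) _ = _
does⇐ (no ¬a) a = contradiction a ¬a

∈-positions : ∀ {m n} (r : Fin m) (c : Fin n) → (r , c) ∈ positions m n
∈-positions r c = ∈-concat⁺′ (∈-map⁺ (r ,_) (∈-allFin c)) (∈-map⁺ _ (∈-allFin r))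

implies⇒ : ∀ {x y} → T (not x ∨ y) → T x → T y
implies⇒ {true} h _ = h

implies⇐ : ∀ {x y} → (T x → T y) → T (not x ∨ y)
implies⇐ {true}  h = h _
implies⇐ {false} h = _

<ᵇ-cancel-+ : ∀ k x y → (k + x <ᵇ k + y) ≡ (x <ᵇ y)
<ᵇ-cancel-+ zero    x y = refl
<ᵇ-cancel-+ (suc k) x y = <ᵇ-cancel-+ k x y

-- A missing next column stands for the virtual column, whose number is n.
NextSpec : ∀ {n} → Fin n → Maybe (Fin n) → Set
NextSpec {n} c nothing   = suc (toℕ c) ≡ n
NextSpec     c (just c′) = toℕ c′ ≡ suc (toℕ c)

nextCol-spec : ∀ {n} (c : Fin n) → NextSpec c (nextCol c)
nextCol-spec {suc zero}    zero    = refl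
nextCol-spec {suc (suc n)} zero    = refl
nextCol-spec {suc (suc n)} (suc c) with nextCol c | nextCol-spec c
... | nothing | eq = cong suc eq
... | just _  | eq = cong suc eq

⟦⟧-split : ∀ x y → ⟦ x ∧ y ⟧ + ⟦ x ∧ not y ⟧ ≡ ⟦ x ⟧
⟦⟧-split false y     = refl
⟦⟧-split true  true  = refl
⟦⟧-split true  false = refl

module _ {m n : ℕ} (t : Filling m n) where
  Surjective : Set
  Surjective = ∀ v → ∃[ r ] ∃[ c ] entry t r c ≡ v

  isInjective⇒ : T (isInjective t) → ∀ {r r′ c c′} → entry t r c ≡ entry t r′ c′ → r ≡ r′ × c ≡ c′
  isInjective⇒ h {r} {r′} {c} {c′} eq =
    let at-rc = all⇒ (positions m n) h (∈-positions r c)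
        at-r′c′ = all⇒ (positions m n) at-rc (∈-positions r′ c′)
        r≟r′ , c≟c′ = to T-∧ (implies⇒ at-r′c′ (does⇐ (_ Fin.≟ _) eq))
    in does⇒ (_ Fin.≟ _) r≟r′ , does⇒ (_ Fin.≟ _) c≟c′

  isInjective⇐ : (∀ {r r′ c c′} → entry t r c ≡ entry t r′ c′ → r ≡ r′ × c ≡ c′) → T (isInjective t)
  isInjective⇐ inj = all⇐ (positions m n) λ (r , c) → all⇐ (positions m n) λ (r′ , c′) → implies⇐ λ eq →
    let r≡r′ , c≡c′ = inj {r} {r′} {c} {c′} (does⇒ (_ Fin.≟ _) eq)
    in from T-∧ (does⇐ (_ Fin.≟ _) r≡r′ , does⇐ (_ Fin.≟ _) c≡c′)

  isSurjective⇒ : T (isSurjective t) → Surjective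
  isSurjective⇒ h v =
    let hit = Any.any⁻ (λ (r , c) → entry t r c ==F v) (positions m n) (all⇒ (allFin (m * n)) h (∈-allFin v))
        (r , c) , _ , eq = find hit
    in r , c , does⇒ (_ Fin.≟ _) eq

  isSurjective⇐ : Surjective → T (isSurjective t)
  isSurjective⇐ surj = all⇐ (allFin (m * n)) λ v → let r , c , eq = surj v in
    Any.any⁺ (λ (r , c) → entry t r c ==F v) (lose (∈-positions r c) (does⇐ (_ Fin.≟ _) eq))

  isRowStandard⇒ : T (isRowStandard t) → ∀ {r c c′} → c <ᶠ c′ → entry t r c <ᶠ entry t r c′
  isRowStandard⇒ h {r} {c} {c′} lt =
    let at-r  = all⇒ (allFin m) h (∈-allFin r)
        at-rc = all⇒ (allFin n) at-r (∈-allFin c)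
    in ℕ.<ᵇ⇒< _ _ (implies⇒ (all⇒ (allFin n) at-rc (∈-allFin c′)) (ℕ.<⇒<ᵇ lt))

  isRowStandard⇐ : (∀ {r c c′} → c <ᶠ c′ → entry t r c <ᶠ entry t r c′) → T (isRowStandard t)
  isRowStandard⇐ rows = all⇐ (allFin m) λ r → all⇐ (allFin n) λ c → all⇐ (allFin n) λ c′ →
    implies⇐ λ lt → ℕ.<⇒<ᵇ (rows {r} {c} {c′} (ℕ.<ᵇ⇒< _ _ lt))

-- Tableaux with a virtual column, and their defects

module Rectangle (m′ n′ : ℕ) where
  -- `K` is spelt out so that `N` computes to `suc K`: then `swap k` with `k : Fin K` acts on
  -- `Fin N`, and `m * n ∸ 1` computes to `K`.
  m n N K : ℕ
  m = suc (suc m′)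
  n = suc n′
  K = n′ + suc m′ * n
  N = m * n

  -- Columns are numbered by naturals so that the virtual column n can be addressed; in the last
  -- column `increasing` compares with it.
  record IsTableau (e : Fin m → ℕ → ℕ) : Set where
    field
      bounded    : ∀ {r c} → c < n → e r c < N
      injective  : ∀ {r r′ c c′} → c < n → c′ < n → e r c ≡ e r′ c′ → r ≡ r′ × c ≡ c′
      increasing : ∀ {r c} → c < n → e r c < e r (suc c)
      final      : ∀ r → e r n ≡ N + toℕ r

  record SingleDefect (e : Fin m → ℕ → ℕ) (c₀ : ℕ) (a b : Fin m) : Set where
    field
      c₀<n   : c₀ < n
      here<  : e a c₀ < e b c₀
      next<  : e a (suc c₀) < e b (suc c₀)
      others : ∀ {c r r′} → c < n → e r c < e r′ c →
               e r′ (suc c) < e r (suc c) ⊎ (c ≡ c₀ × r ≡ a × r′ ≡ b)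

  -- By `others` of the first defect, the second ascent is either reversed in the next column, which
  -- its own `next<` forbids, or it is the first one.
  defect-unique : ∀ {e c₀ a b c₀′ a′ b′} → SingleDefect e c₀ a b → SingleDefect e c₀′ a′ b′ →
                  c₀′ ≡ c₀ × a′ ≡ a × b′ ≡ b
  defect-unique D D′ with SingleDefect.others D (SingleDefect.c₀<n D′) (SingleDefect.here< D′)
  ... | inj₁ inv = contradiction inv (ℕ.<-asym (SingleDefect.next< D′))
  ... | inj₂ eqs = eqs

  -- p c r is the rank of row r in column c of the tableau with defect (c₀ , a , b).
  -- Columns right of c₀ are alternately increasing and decreasing; the columns
  -- up to c₀ look the same after the rows a and b have been exchanged.
  module Ranks (c₀ : ℕ) (c₀<n : c₀ < n) (i : Fin (suc m′)) where

    -- The ranking that column `c₀` would have without a defect. It puts b at rank i and a at rank i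
    -- + 1; the actual ranking exchanges the two.
    ρ : Fin m → Fin m
    ρ = flips (n ∸ c₀)

    a b : Fin m
    a = ρ (suc i)
    b = ρ (inject₁ i)

    ρa : ρ a ≡ suc i
    ρa = flips-involutive (n ∸ c₀) _
    ρb : ρ b ≡ inject₁ i
    ρb = flips-involutive (n ∸ c₀) _

    ∸-suc : ∀ {c} → c < n → n ∸ c ≡ suc (n ∸ suc c)
    ∸-suc {c} c<n = ℕ.+-∸-assoc 1 c<n

    abstract
      -- Up to column `c₀` this is the transposition `swap i` conjugated by `ρ`, that is, the
      -- exchange of the rows `a` and `b`.
      relabel : ∀ {c} → Dec (c₀ < c) → Fin m → Fin m
      relabel (yes _) r = r
      relabel (no _)  r = ρ (swap i (ρ r))

      p : ℕ → Fin m → Fin m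
      p c r = flips (n ∸ c) (relabel (c₀ ℕ.<? c) r)

      p-after : ∀ {c} → c₀ < c → ∀ r → p c r ≡ flips (n ∸ c) r
      p-after {c} c₀<c r with c₀ ℕ.<? c
      ... | yes _ = refl
      ... | no ¬p = contradiction c₀<c ¬p

      p-at : ∀ r → p c₀ r ≡ swap i (ρ r)
      p-at r with c₀ ℕ.<? c₀
      ... | yes q = contradiction q (ℕ.<-irrefl refl)
      ... | no _  = flips-involutive (n ∸ c₀) _

      -- For c ≠ c₀, c₀ < c holds exactly when c₀ < c + 1 does, so both columns use the same
      -- relabelling and differ by one reversal.
      p-flip : ∀ {c} → c < n → c ≢ c₀ → ∀ r → p c r ≡ opposite (p (suc c) r)
      p-flip {c} c<n c≢c₀ r rewrite ∸-suc c<n with c₀ ℕ.<? c | c₀ ℕ.<? suc c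
      ... | yes _ | yes _ = refl
      ... | no _  | no _  = refl
      ... | yes q | no ¬q = contradiction (ℕ.m<n⇒m<1+n q) ¬q
      ... | no ¬q | yes q = contradiction (sym (ℕ.≤∧≮⇒≡ (ℕ.s≤s⁻¹ q) ¬q)) c≢c₀

      relabel-involutive : ∀ {c} (d : Dec (c₀ < c)) r → relabel d (relabel d r) ≡ r
      relabel-involutive (yes _) r = refl
      relabel-involutive (no _)  r = begin
        ρ (swap i (ρ (ρ (swap i (ρ r))))) ≡⟨ cong (ρ ∘ swap i) (flips-involutive (n ∸ c₀) _) ⟩
        ρ (swap i (swap i (ρ r)))         ≡⟨ cong ρ (swap-involutive i _) ⟩
        ρ (ρ r)                           ≡⟨ flips-involutive (n ∸ c₀) _ ⟩
        r                                 ∎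
        where open ≡-Reasoning

      p⁻¹ : ℕ → Fin m → Fin m
      p⁻¹ c x = relabel (c₀ ℕ.<? c) (flips (n ∸ c) x)

      p⁻¹∘p : ∀ c r → p⁻¹ c (p c r) ≡ r
      p⁻¹∘p c r = trans (cong (relabel (c₀ ℕ.<? c)) (flips-involutive (n ∸ c) _))
                      (relabel-involutive (c₀ ℕ.<? c) r)

      p∘p⁻¹ : ∀ c x → p c (p⁻¹ c x) ≡ x
      p∘p⁻¹ c x = trans (cong (flips (n ∸ c)) (relabel-involutive (c₀ ℕ.<? c) _))
                      (flips-involutive (n ∸ c) x)

    p-end : ∀ r → p n r ≡ r
    p-end r rewrite p-after c₀<n r | ℕ.n∸n≡0 n′ = refl

    p-suc : ∀ r → p (suc c₀) r ≡ opposite (ρ r)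
    p-suc r rewrite p-after (ℕ.n<1+n c₀) r | ∸-suc c₀<n = sym (Fin.opposite-involutive _)

    p-injective : ∀ c {r r′} → p c r ≡ p c r′ → r ≡ r′
    p-injective c {r} {r′} eq = trans (sym (p⁻¹∘p c r)) (trans (cong (p⁻¹ c) eq) (p⁻¹∘p c r′))

    ρ-injective : ∀ {r r′} → ρ r ≡ ρ r′ → r ≡ r′
    ρ-injective {r} {r′} eq = trans (sym (flips-involutive (n ∸ c₀) r))
                                    (trans (cong ρ eq) (flips-involutive (n ∸ c₀) r′))

    p-at-a : p c₀ a ≡ inject₁ i
    p-at-a = trans (p-at a) (trans (cong (swap i) ρa) (swap-suc i))
    p-at-b : p c₀ b ≡ suc i
    p-at-b = trans (p-at b) (trans (cong (swap i) ρb) (swap-inject₁ i))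

    -- Column `c₀` is ranked by `swap i` after `ρ`, the next column by the reversal of `ρ`, so only
    -- the pair exchanged by `swap i` keeps its order. Elsewhere `p-flip` reverses everything.
    p-reverse : ∀ {c r r′} → c < n → p c r <ᶠ p c r′ →
                p (suc c) r′ <ᶠ p (suc c) r ⊎ (c ≡ c₀ × r ≡ a × r′ ≡ b)
    p-reverse {c} {r} {r′} c<n lt with c ℕ.≟ c₀
    ... | no c≢c₀ = inj₁ (opposite-cancel-<
                      (subst₂ _<ᶠ_ (p-flip c<n c≢c₀ r) (p-flip c<n c≢c₀ r′) lt))
    ... | yes refl with swap-mono-< i (subst₂ _<ᶠ_ (p-at r) (p-at r′) lt)
    ...   | inj₁ q = inj₁ (subst₂ _<ᶠ_ (sym (p-suc r′)) (sym (p-suc r))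
                       (opposite-anti-< (subst₂ _<ᶠ_ (swap-involutive i _) (swap-involutive i _) q)))
    ...   | inj₂ (q , q′) = inj₂ (refl , p-injective c₀ (trans (p-at r) (trans q (sym p-at-a)))
                                       , p-injective c₀ (trans (p-at r′) (trans q′ (sym p-at-b))))

    p-suc-defect : p (suc c₀) a <ᶠ p (suc c₀) b
    p-suc-defect = subst₂ _<ᶠ_ (sym (trans (p-suc a) (cong opposite ρa)))
                               (sym (trans (p-suc b) (cong opposite ρb)))
                     (opposite-anti-< (inject₁<suc i))

  -- Extending a filling by the virtual column

  abstract
    extension : (Fin m → Fin n → Fin N) → Fin m → ℕ → ℕ
    extension f r = extend (toℕ ∘ f r) (N + toℕ r)

    extension-toℕ : ∀ f r c → extension f r (toℕ c) ≡ toℕ (f r c)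
    extension-toℕ f r = extend-toℕ (toℕ ∘ f r) _

    extension-end : ∀ f r → extension f r n ≡ N + toℕ r
    extension-end f r = extend-end (toℕ ∘ f r) _

    extension-cong : ∀ {f g} → (∀ r c → f r c ≡ g r c) → ∀ r c → extension f r c ≡ extension g r c
    extension-cong eq r = extend-cong (N + toℕ r) (cong toℕ ∘ eq r)

  extension-isTableau : ∀ f → (∀ {r r′ c c′} → f r c ≡ f r′ c′ → r ≡ r′ × c ≡ c′) →
                        (∀ {r c c′} → toℕ c′ ≡ suc (toℕ c) → f r c <ᶠ f r c′) → IsTableau (extension f)
  extension-isTableau f f-injective f-row = record
    { bounded    = λ {r} c<n → bounded r (at c<n)
    ; injective  = λ {r} {r′} c<n c′<n → injective r r′ (at c<n) (at c′<n)
    ; increasing = λ {r} c<n → increasing r (at c<n)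
    ; final      = extension-end f
    }
    where
    bounded : ∀ r {c} → ∃[ x ] toℕ x ≡ c → extension f r c < N
    bounded r (c , refl) = subst (_< N) (sym (extension-toℕ f r c)) (Fin.toℕ<n (f r c))
    injective : ∀ r r′ {c c′} → ∃[ x ] toℕ x ≡ c → ∃[ x ] toℕ x ≡ c′ →
                extension f r c ≡ extension f r′ c′ → r ≡ r′ × c ≡ c′
    injective r r′ (c , refl) (c′ , refl) eq = map₂ (cong toℕ) (f-injective (Fin.toℕ-injective
      (trans (sym (extension-toℕ f r c)) (trans eq (extension-toℕ f r′ c′)))))
    increasing : ∀ r {c} → ∃[ x ] toℕ x ≡ c → extension f r c < extension f r (suc c)
    increasing r (c , refl) with ℕ.m≤n⇒m<n∨m≡n (Fin.toℕ<n c)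
    ... | inj₁ sc<n with c′ , next ← at sc<n =
      subst₂ _<_ (sym (extension-toℕ f r c))
        (trans (sym (extension-toℕ f r c′)) (cong (extension f r) next)) (f-row next)
    -- The right neighbour of the last column is virtual, and N bounds the actual entries from
    -- above.
    ... | inj₂ eq =
      subst₂ _<_ (sym (extension-toℕ f r c))
        (trans (sym (extension-end f r)) (cong (extension f r) (sym eq)))
        (ℕ.<-≤-trans (Fin.toℕ<n (f r c)) (ℕ.m≤m+n N (toℕ r)))

  -- Numbering the values column by column, with rank j in column c as m c + j

  abstract
    val : Fin n → Fin m → Fin N
    val c j = cast (ℕ.*-comm n m) (combine c j)

    toℕ-val : ∀ c j → toℕ (val c j) ≡ m * toℕ c + toℕ j
    toℕ-val c j = trans (Fin.toℕ-cast _ (combine c j)) (Fin.toℕ-combine c j)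

    val-monoˡ : ∀ {c c′} j j′ → c <ᶠ c′ → val c j <ᶠ val c′ j′
    val-monoˡ {c} {c′} j j′ c<c′ =
      subst₂ _<_ (sym (Fin.toℕ-cast _ (combine c j))) (sym (Fin.toℕ-cast _ (combine c′ j′)))
        (Fin.combine-monoˡ-< j j′ c<c′)

    val-monoʳ : ∀ c {j j′} → j <ᶠ j′ → val c j <ᶠ val c j′
    val-monoʳ c {j} {j′} j<j′ =
      subst₂ _<_ (sym (toℕ-val c j)) (sym (toℕ-val c j′)) (ℕ.+-monoʳ-< (m * toℕ c) j<j′)

    val-injective : ∀ {c c′ j j′} → val c j ≡ val c′ j′ → c ≡ c′ × j ≡ j′
    val-injective {c} {c′} {j} {j′} eq = Fin.combine-injective c j c′ j′
      (Fin.toℕ-injective (trans (sym (Fin.toℕ-cast _ (combine c j)))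
        (trans (cong toℕ eq) (Fin.toℕ-cast _ (combine c′ j′)))))

    val-surjective : ∀ v → ∃[ c ] ∃[ j ] val c j ≡ v
    val-surjective v with c , j , eq ← Fin.combine-surjective (cast (ℕ.*-comm m n) v) =
      c , j , trans (cong (cast _) eq) (Fin.cast-involutive _ (ℕ.*-comm m n) v)

    val-cancel-< : ∀ {c c′ j j′} → val c j <ᶠ val c′ j′ → c <ᶠ c′ ⊎ (c ≡ c′ × j <ᶠ j′)
    val-cancel-< {c} {c′} {j} {j′} lt with Fin.<-cmp c c′
    ... | tri< c<c′ _ _ = inj₁ c<c′
    ... | tri> _ _ c>c′ = contradiction lt (ℕ.<-asym (val-monoˡ j′ j c>c′))
    ... | tri≈ _ refl _ = inj₂ (refl ,
      ℕ.+-cancelˡ-< (m * toℕ c) _ _ (subst₂ _<_ (toℕ-val c j) (toℕ-val c j′) lt))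

  val-suc : ∀ c (i : Fin (suc m′)) {k : Fin K} → inject₁ k ≡ val c (inject₁ i) → val c (suc i) ≡ suc k
  val-suc c i {k} eq = Fin.toℕ-injective (begin
    toℕ (val c (suc i))               ≡⟨ toℕ-val c (suc i) ⟩
    m * toℕ c + suc (toℕ i)           ≡⟨ ℕ.+-suc (m * toℕ c) (toℕ i) ⟩
    suc (m * toℕ c + toℕ i)           ≡⟨ cong (λ x → suc (m * toℕ c + x)) (Fin.toℕ-inject₁ i) ⟨
    suc (m * toℕ c + toℕ (inject₁ i)) ≡⟨ cong suc (toℕ-val c (inject₁ i)) ⟨
    suc (toℕ (val c (inject₁ i)))     ≡⟨ cong (suc ∘ toℕ) eq ⟨
    suc (toℕ (inject₁ k))             ≡⟨ cong suc (Fin.toℕ-inject₁ k) ⟩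
    suc (toℕ k)                       ∎)
    where open ≡-Reasoning

  top : Fin m
  top = fromℕ (suc m′)

  -- The carry: m c + (m - 1) + 1 = m (c + 1) + 0.
  val-carry : ∀ {c c′} {k : Fin K} → inject₁ k ≡ val c top → toℕ c′ ≡ suc (toℕ c) → val c′ zero ≡ suc k
  val-carry {c} {c′} {k} eq next = Fin.toℕ-injective (begin
    toℕ (val c′ zero)              ≡⟨ toℕ-val c′ zero ⟩
    m * toℕ c′ + 0                 ≡⟨ ℕ.+-identityʳ _ ⟩
    m * toℕ c′                     ≡⟨ cong (m *_) next ⟩
    m * suc (toℕ c)                ≡⟨ ℕ.*-suc m (toℕ c) ⟩
    m + m * toℕ c                  ≡⟨ ℕ.+-comm m _ ⟩
    m * toℕ c + m                  ≡⟨ ℕ.+-suc (m * toℕ c) (suc m′) ⟩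
    suc (m * toℕ c + suc m′)       ≡⟨ cong (λ x → suc (m * toℕ c + x)) (Fin.toℕ-fromℕ (suc m′)) ⟨
    suc (m * toℕ c + toℕ top)      ≡⟨ cong suc (toℕ-val c top) ⟨
    suc (toℕ (val c top))          ≡⟨ cong (suc ∘ toℕ) eq ⟨
    suc (toℕ (inject₁ k))          ≡⟨ cong suc (Fin.toℕ-inject₁ k) ⟩
    suc (toℕ k)                    ∎)
    where open ≡-Reasoning

  -- The two ways of reading k = m c + j off the defect; in the special case the
  -- values k and k + 1, the top of column c and the bottom of the next one, are
  -- exchanged afterwards.
  data Kind (k : Fin K) (c : Fin n) (i : Fin (suc m′)) : Set where
    regular : inject₁ k ≡ val c (inject₁ i) → Kind k c i
    special : i ≡ fromℕ m′ → inject₁ k ≡ val c (suc i) → Kind k c i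

  classify : ∀ k → ∃[ c ] ∃[ i ] Kind k c i
  classify k with c , j , eq ← val-surjective (inject₁ k) with view j
  ... | ‵inject₁ i = c , i , regular (sym eq)
  -- The top rank has no rank above it, so the two highest ranks are exchanged and i is m - 2.
  ... | ‵fromℕ     = c , fromℕ m′ , special refl (sym eq)

  -- The model tableau belonging to k

  module Model {k : Fin K} {c₀ : Fin n} {i : Fin (suc m′)} (κ : Kind k c₀ i) where
    open Ranks (toℕ c₀) (Fin.toℕ<n c₀) i public

    adjust′ : Kind k c₀ i → Fin N → Fin N
    adjust′ (regular _)   = λ x → x
    adjust′ (special _ _) = swap k

    adjust = adjust′ κ

    adjust-involutive : ∀ x → adjust (adjust x) ≡ x
    adjust-involutive x = go κ
      where
      go : ∀ κ → adjust′ κ (adjust′ κ x) ≡ x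
      go (regular _)   = refl
      go (special _ _) = swap-involutive k x

    base : Fin m → Fin n → Fin N
    base r c = val c (p (toℕ c) r)

    -- The value from which k can be read back. In the regular case b has the rank after that of k;
    -- in the special case `base` gives it k, which `swap k` raises.
    τ-b : adjust (base b c₀) ≡ suc k
    τ-b = trans (cong (adjust ∘ val c₀) p-at-b) (go κ)
      where
      go : ∀ κ → adjust′ κ (val c₀ (suc i)) ≡ suc k
      go (regular eq)   = val-suc c₀ i eq
      go (special _ eq) = trans (cong (swap k) (sym eq)) (swap-inject₁ k)

    base-injective : ∀ {r r′ c c′} → base r c ≡ base r′ c′ → r ≡ r′ × c ≡ c′
    base-injective {c = c} {c′} eq with refl , eq′ ← val-injective {c} {c′} eq = p-injective (toℕ c) eq′ , refl

    τ : Fin m → Fin n → Fin N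
    τ r c = adjust (base r c)

    τ-injective : ∀ {r r′ c c′} → τ r c ≡ τ r′ c′ → r ≡ r′ × c ≡ c′
    τ-injective {r} {r′} {c} {c′} eq = base-injective
      (trans (sym (adjust-involutive (base r c))) (trans (cong adjust eq) (adjust-involutive (base r′ c′))))

    τ-surjective : ∀ v → ∃[ r ] ∃[ c ] τ r c ≡ v
    τ-surjective v with c , j , eq ← val-surjective (adjust v) =
      p⁻¹ (toℕ c) j , c , trans (cong adjust (trans (cong (val c) (p∘p⁻¹ (toℕ c) j)) eq)) (adjust-involutive v)

    p-suc-a : i ≡ fromℕ m′ → p (suc (toℕ c₀)) a ≡ zero
    p-suc-a top? = begin
      p (suc (toℕ c₀)) a      ≡⟨ p-suc a ⟩
      opposite (ρ a)          ≡⟨ cong opposite ρa ⟩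
      -- `opposite zero` is the top rank and computes to `suc (fromℕ m′)`.
      opposite (suc i)        ≡⟨ cong (opposite ∘ suc) top? ⟩
      opposite (opposite zero) ≡⟨ Fin.opposite-involutive zero ⟩
      zero                    ∎
      where open ≡-Reasoning

    base-next-a : i ≡ fromℕ m′ → inject₁ k ≡ val c₀ (suc i) → ∀ {c} → toℕ c ≡ suc (toℕ c₀) → base a c ≡ suc k
    base-next-a top? eq {c} next = trans (cong (val c) (trans (cong (λ x → p x a) next) (p-suc-a top?)))
      (val-carry (trans eq (cong (val c₀ ∘ suc) top?)) next)

    -- In `base` the value k belongs to (b , c₀), at the top rank. So k + 1 lies in a later column,
    -- which shows that column c₀ + 1 exists; there a has rank 0 and therefore the value k + 1.
    -- Injectivity does the rest.
    swapped-positions : i ≡ fromℕ m′ → inject₁ k ≡ val c₀ (suc i) → ∀ {r c r′ c′} →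
                        base r c ≡ inject₁ k → base r′ c′ ≡ suc k →
                        r ≡ b × c ≡ c₀ × r′ ≡ a × toℕ c′ ≡ suc (toℕ c₀)
    swapped-positions top? eq {r} {c} {r′} {c′} q q′
      with val-cancel-< (subst₂ _<ᶠ_ eq (sym q′) (inject₁<suc k))
    ... | inj₂ (_ , lt) = contradiction lt
      (ℕ.≤⇒≯ (subst (λ x → toℕ (p (toℕ c′) r′) ≤ toℕ (suc x)) (sym top?) (Fin.≤fromℕ _)))
    ... | inj₁ c₀<c′ = proj₁ rc≡ , proj₂ rc≡ , proj₁ rc′≡ , trans (cong toℕ (proj₂ rc′≡)) c₁≡
      where
      c₁,c₁≡ : ∃[ x ] toℕ {n} x ≡ suc (toℕ c₀)
      c₁,c₁≡ = at (ℕ.<-≤-trans (s≤s c₀<c′) (Fin.toℕ<n c′))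
      c₁ = proj₁ c₁,c₁≡
      c₁≡ = proj₂ c₁,c₁≡
      rc≡ : r ≡ b × c ≡ c₀
      rc≡ = base-injective (trans q (trans eq (cong (val c₀) (sym p-at-b))))
      rc′≡ : r′ ≡ a × c′ ≡ c₁
      rc′≡ = base-injective (trans q′ (sym (base-next-a top? eq c₁≡)))

    -- Only the values k and k + 1 can lose their order, by `swap-mono-<`, and `swapped-positions`
    -- tells in which cells they stand.
    τ-mono : ∀ {r c r′ c′} → base r c <ᶠ base r′ c′ →
             τ r c <ᶠ τ r′ c′ ⊎ (r ≡ b × c ≡ c₀ × r′ ≡ a × toℕ c′ ≡ suc (toℕ c₀))
    τ-mono {r} {c} {r′} {c′} lt = go κ
      where
      go : ∀ κ → adjust′ κ (base r c) <ᶠ adjust′ κ (base r′ c′) ⊎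
                 (r ≡ b × c ≡ c₀ × r′ ≡ a × toℕ c′ ≡ suc (toℕ c₀))
      go (regular _) = inj₁ lt
      go (special top? eq) with swap-mono-< k lt
      ... | inj₁ q        = inj₁ q
      ... | inj₂ (q , q′) = inj₂ (swapped-positions top? eq {r} {c} {r′} {c′} q q′)

    -- The exchanged cells lie in different columns, so the order inside a column survives.
    τ-col : ∀ {r r′} c → p (toℕ c) r <ᶠ p (toℕ c) r′ → τ r c <ᶠ τ r′ c
    τ-col {r} {r′} c lt with τ-mono {r} {c} {r′} {c} (val-monoʳ c lt)
    ... | inj₁ q = q
    ... | inj₂ (_ , c≡c₀ , _ , next) = contradiction (trans (sym next) (cong toℕ c≡c₀)) ℕ.1+n≢n

    e : Fin m → ℕ → ℕ
    e = extension τ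

    e-mono : ∀ {c r r′} → c ≤ n → p c r <ᶠ p c r′ → e r c < e r′ c
    e-mono {c} {r} {r′} c≤n lt with ℕ.m≤n⇒m<n∨m≡n c≤n
    ... | inj₁ c<n with c , refl ← at c<n =
      subst₂ _<_ (sym (extension-toℕ τ r c)) (sym (extension-toℕ τ r′ c)) (τ-col c lt)
    ... | inj₂ refl = subst₂ _<_ (sym (extension-end τ r)) (sym (extension-end τ r′))
                        (ℕ.+-monoʳ-< N (subst₂ _<ᶠ_ (p-end r) (p-end r′) lt))

    e-cancel : ∀ {c r r′} → c ≤ n → e r c < e r′ c → p c r <ᶠ p c r′
    e-cancel {c} {r} {r′} c≤n lt with Fin.<-cmp (p c r) (p c r′)
    ... | tri< q _ _ = q
    ... | tri≈ _ q _ = contradiction lt (ℕ.<-irrefl (cong (λ r → e r c) (p-injective c q)))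
    ... | tri> _ _ q = contradiction lt (ℕ.<-asym (e-mono c≤n q))

    -- The exchanged cells lie in the different rows b and a, so the order inside a row survives.
    τ-row : ∀ {r c c′} → toℕ c′ ≡ suc (toℕ c) → τ r c <ᶠ τ r c′
    τ-row {r} {c} {c′} next with τ-mono {r} {c} {r} {c′} (val-monoˡ _ _ (ℕ.≤-reflexive (sym next)))
    ... | inj₁ q = q
    ... | inj₂ (r≡b , _ , r≡a , _) =
      contradiction (trans (sym ρb) (trans (cong ρ (trans (sym r≡b) r≡a)) ρa)) (inject₁≢suc i)

    τ-isTableau : IsTableau e
    τ-isTableau = extension-isTableau τ (λ {r} {r′} {c} {c′} → τ-injective {r} {r′} {c} {c′}) τ-row

    τ-singleDefect : SingleDefect e (toℕ c₀) a b
    τ-singleDefect = record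
      { c₀<n   = Fin.toℕ<n c₀
      ; here<  = e-mono (ℕ.<⇒≤ (Fin.toℕ<n c₀)) (subst₂ _<ᶠ_ (sym p-at-a) (sym p-at-b) (inject₁<suc i))
      ; next<  = e-mono (Fin.toℕ<n c₀) p-suc-defect
      ; others = λ c<n lt → Sum.map₁ (e-mono c<n) (p-reverse c<n (e-cancel (ℕ.<⇒≤ c<n) lt))
      }

    e-b : e b (toℕ c₀) ≡ suc (toℕ k)
    e-b = trans (extension-toℕ τ b c₀) (cong toℕ τ-b)

  -- How a single defect forces the order of every column

  module Tableau {e : Fin m → ℕ → ℕ} (T : IsTableau e) where
    open IsTableau T

    row-mono-≤ : ∀ {r c c′} → c ≤ c′ → c′ ≤ n → e r c ≤ e r c′
    row-mono-≤ {r} {c} {c′} c≤c′ c′≤n with ℕ.m≤n⇒m<n∨m≡n c≤c′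
    ... | inj₂ refl = ℕ.≤-refl
    row-mono-≤ {r} {c} {suc c′} _ c′<n | inj₁ (s≤s c≤c′) =
      ℕ.≤-trans (row-mono-≤ c≤c′ (ℕ.<⇒≤ c′<n)) (ℕ.<⇒≤ (increasing c′<n))

    row-mono-< : ∀ {r c c′} → c < c′ → c′ ≤ n → e r c < e r c′
    row-mono-< c<c′ c′≤n = ℕ.<-≤-trans (increasing (ℕ.<-≤-trans c<c′ c′≤n)) (row-mono-≤ c<c′ c′≤n)

    column-injective : ∀ {r r′ c} → c ≤ n → e r c ≡ e r′ c → r ≡ r′
    column-injective {r} {r′} c≤n eq with ℕ.m≤n⇒m<n∨m≡n c≤n
    ... | inj₁ c<n  = proj₁ (injective c<n c<n eq)
    ... | inj₂ refl = Fin.toℕ-injective (ℕ.+-cancelˡ-≡ N _ _ (trans (sym (final r)) (trans eq (final r′))))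

  module ExtensionTableau (f : Fin m → Fin n → Fin N) (T : IsTableau (extension f)) where
    open IsTableau T

    pair-injective : ∀ {r c r′ c′} → f r c ≡ f r′ c′ → (r , c) ≡ (r′ , c′)
    pair-injective {r} {c} {r′} {c′} eq
      with refl , c≡c′ ← injective (Fin.toℕ<n c) (Fin.toℕ<n c′)
                           (trans (extension-toℕ f r c) (trans (cong toℕ eq) (sym (extension-toℕ f r′ c′)))) =
      cong (r ,_) (Fin.toℕ-injective c≡c′)

  module Analysis {e : Fin m → ℕ → ℕ} (T : IsTableau e)
                  {c₀ : Fin n} {a b : Fin m} (D : SingleDefect e (toℕ c₀) a b) where
    open IsTableau T
    open Tableau T
    open SingleDefect D

    -- If r is below r′ in value at column c, move right along r′. If it is above, the pair is
    -- either reversed at c + 1, and moving right along r suffices, or it is the defect.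
    cross : ∀ {r r′ c} → c < n → e r c < e r′ (suc c) ⊎ (r ≡ b × c ≡ toℕ c₀ × r′ ≡ a)
    cross {r} {r′} {c} c<n with ℕ.<-cmp (e r c) (e r′ c)
    ... | tri< lt _ _ = inj₁ (ℕ.<-trans lt (increasing c<n))
    ... | tri≈ _ eq _ with refl , _ ← injective c<n c<n eq = inj₁ (increasing c<n)
    ... | tri> _ _ gt with others c<n gt
    ...   | inj₁ lt                 = inj₁ (ℕ.<-trans (increasing c<n) lt)
    ...   | inj₂ (c≡c₀ , r′≡a , r≡b) = inj₂ (r≡b , c≡c₀ , r′≡a)

    -- If crossing directly at c fails, then c = c₀. When c′ > c + 1, one can still move right along
    -- r first and cross at c + 1, where no defect is.
    cross* : ∀ {r r′ c c′} → c < c′ → c′ < n →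
             e r c < e r′ c′ ⊎ (r ≡ b × c ≡ toℕ c₀ × r′ ≡ a × c′ ≡ suc (toℕ c₀))
    cross* {r} {r′} c<c′ c′<n with cross {r} {r′} (ℕ.<-trans c<c′ c′<n)
    ... | inj₁ lt = inj₁ (ℕ.<-≤-trans lt (row-mono-≤ c<c′ (ℕ.<⇒≤ c′<n)))
    ... | inj₂ (r≡b , c≡c₀ , r′≡a) with ℕ.m≤n⇒m<n∨m≡n c<c′
    ...   | inj₂ eq = inj₂ (r≡b , c≡c₀ , r′≡a , trans (sym eq) (cong suc c≡c₀))
    ...   | inj₁ sc<c′ with cross {r} {r′} (ℕ.<-trans sc<c′ c′<n)
    ...     | inj₂ (_ , sc≡c₀ , _) = contradiction (trans sc≡c₀ (sym c≡c₀)) ℕ.1+n≢n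
    ...     | inj₁ lt = inj₁ (ℕ.<-trans (increasing (ℕ.<-trans c<c′ c′<n))
                              (ℕ.<-≤-trans lt (row-mono-≤ sc<c′ (ℕ.<⇒≤ c′<n))))

    -- Induction on the distance d to the virtual column, which is ordered by row number. As c₀ < c,
    -- each step to the left is a full reversal.
    order-after : ∀ d {c} → d + c ≡ n → toℕ c₀ < c → ∀ {r r′} → e r c < e r′ c → flips d r <ᶠ flips d r′
    order-after zero    refl c₀<c {r} {r′} lt = ℕ.+-cancelˡ-< N _ _ (subst₂ _<_ (final r) (final r′) lt)
    order-after (suc d) {c} eq c₀<c {r} {r′} lt with others (subst (c <_) eq (s≤s (ℕ.m≤n+m c d))) lt
    ... | inj₁ inv          = opposite-anti-< (order-after d (trans (ℕ.+-suc d c) eq) (ℕ.m<n⇒m<1+n c₀<c) inv)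
    ... | inj₂ (c≡c₀ , _) = contradiction (sym c≡c₀) (ℕ.<⇒≢ c₀<c)

    ρ₀ : Fin m → Fin m
    ρ₀ = flips (n ∸ toℕ c₀)

    ρ₀-involutive : ∀ r → ρ₀ (ρ₀ r) ≡ r
    ρ₀-involutive = flips-involutive (n ∸ toℕ c₀)

    ρ₀-suc : ∀ r → ρ₀ r ≡ opposite (flips (n ∸ suc (toℕ c₀)) r)
    ρ₀-suc r = cong (λ d → flips d r) (ℕ.+-∸-assoc 1 c₀<n)

    ρ₀-reverse : ∀ {r r′} → e r (suc (toℕ c₀)) < e r′ (suc (toℕ c₀)) → ρ₀ r′ <ᶠ ρ₀ r
    ρ₀-reverse {r} {r′} lt = subst₂ _<ᶠ_ (sym (ρ₀-suc r′)) (sym (ρ₀-suc r))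
      (opposite-anti-< (order-after (n ∸ suc (toℕ c₀)) (ℕ.m∸n+n≡m c₀<n) (ℕ.n<1+n _) lt))

    order-at : ∀ {r r′} → e r (toℕ c₀) < e r′ (toℕ c₀) → ρ₀ r <ᶠ ρ₀ r′ ⊎ (r ≡ a × r′ ≡ b)
    order-at lt with others c₀<n lt
    ... | inj₁ inv       = inj₁ (ρ₀-reverse inv)
    ... | inj₂ (_ , eqs) = inj₂ eqs

    abstract
      -- In column `c₀` only the pair (a , b) departs from the order given by `ρ₀`. A row ranked
      -- strictly between b and a would thus be above b and below a in value there, although a is
      -- below b.
      adjacent : ∃[ i ] ρ₀ b ≡ inject₁ i × ρ₀ a ≡ suc i
      adjacent = consecutive (ρ₀-reverse next<) none-between
        where
        none-between : ∀ (x : Fin m) → ρ₀ b <ᶠ x → x <ᶠ ρ₀ a → ⊥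
        none-between x b<x x<a with ℕ.<-cmp (e (ρ₀ x) (toℕ c₀)) (e a (toℕ c₀))
        ... | tri≈ _ eq _ = ℕ.<-irrefl (cong toℕ (trans (sym (ρ₀-involutive x))
                              (cong ρ₀ (proj₁ (injective c₀<n c₀<n eq))))) x<a
        ... | tri< lt _ _ with order-at (ℕ.<-trans lt here<)
        ...   | inj₁ x<b       = ℕ.<-asym b<x (subst (_<ᶠ ρ₀ b) (ρ₀-involutive x) x<b)
        ...   | inj₂ (x≡a , _) = ℕ.<-irrefl (cong (λ r → e r (toℕ c₀)) x≡a) lt
        none-between x b<x x<a | tri> _ _ gt with order-at gt
        ...   | inj₁ a<x       = ℕ.<-asym x<a (subst (ρ₀ a <ᶠ_) (ρ₀-involutive x) a<x)
        ...   | inj₂ (_ , x≡b) = ℕ.<-irrefl (cong toℕ (trans (sym (cong ρ₀ x≡b)) (ρ₀-involutive x))) b<x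

    i : Fin (suc m′)
    i = proj₁ adjacent

    open Ranks (toℕ c₀) (Fin.toℕ<n c₀) i 
      using (p; p⁻¹; p∘p⁻¹; p-at; p-at-a; p-at-b; p-after; p-flip; ρ-injective)
      renaming (a to a′; b to b′)

    -- `Ranks` builds its two rows from `c₀` and `i` alone; they have to be matched with the rows of
    -- the given defect.
    a′≡a : a′ ≡ a
    a′≡a = trans (cong ρ₀ (sym (proj₂ (proj₂ adjacent)))) (ρ₀-involutive a)

    b′≡b : b′ ≡ b
    b′≡b = trans (cong ρ₀ (sym (proj₁ (proj₂ adjacent)))) (ρ₀-involutive b)

    -- Induction on the distance d to column `c₀`; the defect enters only in the base case, and each
    -- further step to the left reverses.
    order-before : ∀ d {c} → d + c ≡ toℕ c₀ → ∀ {r r′} → e r c < e r′ c → p c r <ᶠ p c r′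
    order-before zero refl {r} {r′} lt with order-at lt
    ... | inj₂ (refl , refl) = subst₂ _<ᶠ_ (trans (sym p-at-a) (cong (p (toℕ c₀)) a′≡a))
                                 (trans (sym p-at-b) (cong (p (toℕ c₀)) b′≡b)) (inject₁<suc i)
    ... | inj₁ ρ< with swap-mono-< i ρ<
    ...   | inj₁ q = subst₂ _<ᶠ_ (sym (p-at r)) (sym (p-at r′)) q
    -- Here r would be b and r′ would be a, against the order of the defect.
    ...   | inj₂ (q , q′)
      with refl ← ρ-injective {r} {b} (trans q (sym (proj₁ (proj₂ adjacent))))
         | refl ← ρ-injective {r′} {a} (trans q′ (sym (proj₂ (proj₂ adjacent)))) =
      contradiction lt (ℕ.<-asym here<)
    order-before (suc d) {c} eq {r} {r′} lt = go (others c<n lt)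
      where
      c<c₀ : c < toℕ c₀
      c<c₀ = subst (c <_) eq (s≤s (ℕ.m≤n+m c d))
      c<n : c < n
      c<n = ℕ.<-trans c<c₀ c₀<n
      flip : ∀ r → opposite (p (suc c) r) ≡ p c r
      flip r = sym (p-flip c<n (ℕ.<⇒≢ c<c₀) r)
      go : _ → p c r <ᶠ p c r′
      go (inj₁ inv)        = subst₂ _<ᶠ_ (flip r) (flip r′)
        (opposite-anti-< (order-before d (trans (ℕ.+-suc d c) eq) inv))
      go (inj₂ (c≡c₀ , _)) = contradiction c≡c₀ (ℕ.<⇒≢ c<c₀)

    order : ∀ {c} → c < n → ∀ {r r′} → e r c < e r′ c → p c r <ᶠ p c r′
    order {c} c<n {r} {r′} lt with c ℕ.≤? toℕ c₀
    ... | yes c≤c₀ = order-before (toℕ c₀ ∸ c) (ℕ.m∸n+n≡m c≤c₀) lt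
    ... | no  c≰c₀ = subst₂ _<ᶠ_ (sym (p-after (ℕ.≰⇒> c≰c₀) r)) (sym (p-after (ℕ.≰⇒> c≰c₀) r′))
                       (order-after (n ∸ c) (ℕ.m∸n+n≡m (ℕ.<⇒≤ c<n)) (ℕ.≰⇒> c≰c₀) lt)

    val-i< : val c₀ (inject₁ i) <ᶠ val c₀ (suc i)
    val-i< = val-monoʳ c₀ (inject₁<suc i)

    -- An entry above b in column c₀ would be smaller than (a , c₀ + 1), so b would be too.
    special⇒top : e a (suc (toℕ c₀)) < e b (toℕ c₀) → i ≡ fromℕ m′
    special⇒top lt = sym (Fin.suc-injective (begin
      top               ≡⟨ p∘p⁻¹ (toℕ c₀) top ⟨
      p (toℕ c₀) t      ≡⟨ cong (p (toℕ c₀)) (trans t≡b (sym b′≡b)) ⟩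
      p (toℕ c₀) b′     ≡⟨ p-at-b ⟩
      suc i             ∎))
      where
      open ≡-Reasoning
      t : Fin m
      t = p⁻¹ (toℕ c₀) top
      t≡b : t ≡ b
      t≡b with ℕ.<-cmp (e t (toℕ c₀)) (e b (toℕ c₀))
      ... | tri≈ _ eq _ = proj₁ (injective c₀<n c₀<n eq)
      ... | tri< t<b _ _ = contradiction (subst (_<ᶠ p (toℕ c₀) b) (p∘p⁻¹ (toℕ c₀) top) (order c₀<n t<b))
                             (ℕ.≤⇒≯ (Fin.≤fromℕ _))
      ... | tri> _ _ b<t with cross {t} {a} c₀<n
      ...   | inj₁ t<a       = contradiction (ℕ.<-trans t<a lt) (ℕ.<-asym b<t)
      ...   | inj₂ (t≡b , _) = t≡b

  -- Reconstruction of a tableau from its defect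

  -- By `orderPreserving⇒≗` it suffices that the model preserves the order in which `f` puts two
  -- cells. Within a column this is `order`; across columns `cross*` leaves only (b , c₀) against (a
  -- , c₀ + 1) in doubt, and this pair decides the kind.
  reconstruct : (f : Fin m → Fin n → Fin N) → (∀ v → ∃[ r ] ∃[ c ] f r c ≡ v) →
                IsTableau (extension f) → ∀ {c₀ a b} → SingleDefect (extension f) (toℕ c₀) a b →
                ∃[ k ] ∃[ i ] ∃ λ (κ : Kind k c₀ i) → ∀ r c → f r c ≡ Model.τ κ r c
  reconstruct f f-surjective T {c₀} {a} {b} D = result
    where
    open Analysis T D
    open IsTableau T
    open ExtensionTableau f T
    open SingleDefect D

    e : Fin m → ℕ → ℕ
    e = extension f

    Special : Set
    Special = e a (suc (toℕ c₀)) < e b (toℕ c₀)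

    preserved-within : ∀ {k} (κ : Kind k c₀ i) {r r′} c → f r c <ᶠ f r′ c → Model.τ κ r c <ᶠ Model.τ κ r′ c
    preserved-within κ {r} {r′} c lt =
      Model.τ-col κ c (order (Fin.toℕ<n c) (subst₂ _<_ (sym (extension-toℕ f r c)) (sym (extension-toℕ f r′ c)) lt))

    backward : ∀ {r c r′ c′} → c′ <ᶠ c → f r c <ᶠ f r′ c′ →
               Special × r ≡ a × toℕ c ≡ suc (toℕ c₀) × r′ ≡ b × c′ ≡ c₀
    backward {r} {c} {r′} {c′} c′<c lt
      with lt′ ← subst₂ _<_ (sym (extension-toℕ f r c)) (sym (extension-toℕ f r′ c′)) lt
      with cross* {r′} {r} c′<c (Fin.toℕ<n c)
    ... | inj₁ gt = contradiction gt (ℕ.<-asym lt′)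
    ... | inj₂ (refl , c′≡c₀ , refl , next) =
      subst₂ (λ x y → e a x < e b y) next c′≡c₀ lt′ , refl , next , refl , Fin.toℕ-injective c′≡c₀

    preserved : ∀ {k} (κ : Kind k c₀ i) →
                (∀ {r c r′ c′} → c <ᶠ c′ → f r c <ᶠ f r′ c′ → Model.τ κ r c <ᶠ Model.τ κ r′ c′) →
                (Special → ∀ c → toℕ c ≡ suc (toℕ c₀) → Model.τ κ a c <ᶠ Model.τ κ b c₀) →
                ∀ r c → f r c ≡ Model.τ κ r c
    preserved κ forward swapped r c = orderPreserving⇒≗ (λ (r , c) → f r c) (λ (r , c) → Model.τ κ r c)
        (λ v → let r , c , eq = f-surjective v in (r , c) , eq)
        (λ (r , c) (r′ , c′) → mono r c r′ c′)
        (λ (r , c) (r′ , c′) → pair-injective {r} {c} {r′} {c′})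
        (r , c)
      where
      mono : ∀ r c r′ c′ → f r c <ᶠ f r′ c′ → Model.τ κ r c <ᶠ Model.τ κ r′ c′
      mono r c r′ c′ lt with Fin.<-cmp c c′
      ... | tri< c<c′ _ _ = forward c<c′ lt
      ... | tri≈ _ refl _ = preserved-within κ c lt
      ... | tri> _ _ c>c′ with sp , refl , next , refl , refl ← backward c>c′ lt = swapped sp c next

    -- If `c₀` were the last column, its right neighbour in row a would be virtual, at least N, and
    -- could not be below an actual entry.
    suc-c₀<n : Special → suc (toℕ c₀) < n
    suc-c₀<n lt with ℕ.m≤n⇒m<n∨m≡n c₀<n
    ... | inj₁ q = q
    ... | inj₂ q = contradiction
      (ℕ.<-trans (subst (_< e b (toℕ c₀)) (trans (cong (e a) q) (final a)) lt) (bounded c₀<n))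
                     (ℕ.m+n≮m N (toℕ a))

    result : ∃[ k ] ∃[ i ] ∃ λ (κ : Kind k c₀ i) → ∀ r c → f r c ≡ Model.τ κ r c
    result with e a (suc (toℕ c₀)) ℕ.<? e b (toℕ c₀)
    -- The value of rank i in column `c₀` has the value of rank i + 1 above it, so it is not the
    -- largest and comes from `Fin K`.
    ... | no ¬special with k , eq ← x<y⇒inject₁ val-i< =
      k , i , regular eq , preserved (regular eq)
        (λ c<c′ _ → val-monoˡ _ _ c<c′) (λ sp → contradiction sp ¬special)
    -- Column c₀ + 1 exists and its values exceed that of rank i + 1 in column `c₀`, so the latter
    -- comes from `Fin K`.
    ... | yes sp with c₁ , next ← at (suc-c₀<n sp)
                       with k , eq ← x<y⇒inject₁ (val-monoˡ {c₀} {c₁} (suc i) zero (ℕ.≤-reflexive (sym next))) =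
      k , i , κ , preserved κ forward swapped
      where
      κ : Kind k c₀ i
      κ = special (special⇒top sp) eq
      -- The one pair that the model puts out of order, (b , c₀) and (a , c₀ + 1), is out of order
      -- in `f` as well.
      forward : ∀ {r c r′ c′} → c <ᶠ c′ → f r c <ᶠ f r′ c′ → Model.τ κ r c <ᶠ Model.τ κ r′ c′
      forward {r} {c} {r′} {c′} c<c′ lt with Model.τ-mono κ {r} {c} {r′} {c′} (val-monoˡ _ _ c<c′)
      ... | inj₁ q = q
      ... | inj₂ (r≡b , c≡c₀ , r′≡a , next) = contradiction
        (subst₂ _<_ (trans (sym (extension-toℕ f r c)) (cong₂ e (trans r≡b b′≡b) (cong toℕ c≡c₀)))
                    (trans (sym (extension-toℕ f r′ c′)) (cong₂ e (trans r′≡a a′≡a) next)) lt)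
        (ℕ.<-asym sp)
      swapped : Special → ∀ c → toℕ c ≡ suc (toℕ c₀) → Model.τ κ a c <ᶠ Model.τ κ b c₀
      -- `base` has k + 1 at (a , c₀ + 1), which the exchange turns into k, while (b , c₀) receives
      -- k + 1.
      swapped _ c next = subst₂ _<ᶠ_
        (sym (trans (cong (swap k) base-a) (swap-suc k)))
        (trans (sym (Model.τ-b κ)) (cong (λ r → Model.τ κ r c₀) b′≡b))
        (inject₁<suc k)
        where
        base-a : Model.base κ a c ≡ suc k
        base-a = trans (cong (λ r → Model.base κ r c) (sym a′≡a))
                       (Model.base-next-a κ (special⇒top sp) eq next)

  -- Inversions and defects of a filling

  module _ (t : Filling m n) where
    e : Fin m → ℕ → ℕ
    e = extension (entry t)

    ascends reverses : Fin n → Fin m → Fin m → Bool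
    ascends  c r r′ = e r (toℕ c) <ᵇ e r′ (toℕ c)
    reverses c r r′ = e r′ (suc (toℕ c)) <ᵇ e r (suc (toℕ c))

    -- In the last column the next entries are N + r and N + r′, and comparing them compares the
    -- rows; so both clauses of the definition take one form.
    isInversionAt≡ : ∀ c r r′ → isInversionAt t c r r′ ≡ ascends c r r′ ∧ reverses c r r′
    isInversionAt≡ c r r′ with nextCol c | nextCol-spec c
    ... | just c′ | eq = cong₂ _∧_
      (sym (cong₂ _<ᵇ_ (extension-toℕ (entry t) r c) (extension-toℕ (entry t) r′ c)))
      (sym (cong₂ _<ᵇ_ (trans (cong (e r′) (sym eq)) (extension-toℕ (entry t) r′ c′))
                       (trans (cong (e r) (sym eq)) (extension-toℕ (entry t) r c′))))
    ... | nothing | eq = cong₂ _∧_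
      (sym (cong₂ _<ᵇ_ (extension-toℕ (entry t) r c) (extension-toℕ (entry t) r′ c)))
      (sym (trans (cong₂ _<ᵇ_ (trans (cong (e r′) eq) (extension-end (entry t) r′))
                              (trans (cong (e r) eq) (extension-end (entry t) r)))
        (<ᵇ-cancel-+ N (toℕ r′) (toℕ r))))

    defect : Fin n → Fin m → Fin m → ℕ
    defect c r r′ = ⟦ ascends c r r′ ∧ not (reverses c r r′) ⟧

    -- Every column has T_{m-1} ascents, and each ascent is either an inversion or a defect.
    inversions+defects : IsTableau e → inversions t + sum₃ defect ≡ n * triangular (suc m′)
    inversions+defects T = begin
      inversions t + sum₃ defect
        ≡⟨ cong (_+ sum₃ defect) (trans (inversions≡sum {m} {n} t)
             (sum₃-cong (λ c r r′ → cong ⟦_⟧ (isInversionAt≡ c r r′)))) ⟩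
      sum₃ (λ c r r′ → ⟦ ascends c r r′ ∧ reverses c r r′ ⟧) + sum₃ defect
        ≡⟨ sum₃-+ (λ c r r′ → ⟦ ascends c r r′ ∧ reverses c r r′ ⟧) defect ⟨
      sum₃ (λ c r r′ → ⟦ ascends c r r′ ∧ reverses c r r′ ⟧ + defect c r r′)
        ≡⟨ sum₃-cong (λ c r r′ → ⟦⟧-split (ascends c r r′) (reverses c r r′)) ⟩
      sum₃ (λ c r r′ → ⟦ ascends c r r′ ⟧)
        ≡⟨ sum-cong-≗ {n} (λ c → count-ascents (suc m′) (λ r → e r (toℕ c))
             (Tableau.column-injective T (ℕ.<⇒≤ (Fin.toℕ<n c)))) ⟩
      sum {n} (λ _ → triangular (suc m′))
        ≡⟨ sum-const n _ ⟩
      n * triangular (suc m′) ∎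
      where
      open ≡-Reasoning
      sum₃-cong : {x y : Fin n → Fin m → Fin m → ℕ} → (∀ c r r′ → x c r r′ ≡ y c r r′) → sum₃ x ≡ sum₃ y
      sum₃-cong eq = sum-cong-≗ {n} λ c → sum-cong-≗ {m} λ r → sum-cong-≗ {m} (eq c r)
      sum₃-+ : (x y : Fin n → Fin m → Fin m → ℕ) → sum₃ (λ c r r′ → x c r r′ + y c r r′) ≡ sum₃ x + sum₃ y
      sum₃-+ x y = trans (sum-cong-≗ {n} λ c → trans (sum-cong-≗ {m} λ r → ∑-distrib-+ {m} (x c r) (y c r))
          (∑-distrib-+ {m} (λ r → sum (x c r)) (λ r → sum (y c r))))
        (∑-distrib-+ {n} (λ c → sum λ r → sum (x c r)) (λ c → sum λ r → sum (y c r)))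

    inversions⇒defects : IsTableau e → inversions t ≡ n * triangular (suc m′) ∸ 1 → sum₃ defect ≡ 1
    -- The maximum computes to a successor, because n ≥ 1 and m ≥ 2, so the truncated subtraction of
    -- 1 is a true one.
    inversions⇒defects T eq = ℕ.+-cancelˡ-≡ (inversions t) _ _ (trans (inversions+defects T)
      (trans (ℕ.+-comm 1 (n * triangular (suc m′) ∸ 1)) (cong (_+ 1) (sym eq))))

    defects⇒inversions : IsTableau e → sum₃ defect ≡ 1 → inversions t ≡ n * triangular (suc m′) ∸ 1
    defects⇒inversions T eq = cong ℕ.pred (trans (ℕ.+-comm 1 (inversions t))
      (trans (cong (inversions t +_) (sym eq)) (inversions+defects T)))

    SomeDefect : Set
    SomeDefect = ∃ λ (c₀ : Fin n) → ∃[ a ] ∃[ b ] SingleDefect e (toℕ c₀) a b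

    ⟦⟧≡1⇒ : ∀ {x y} → ⟦ x ∧ not y ⟧ ≡ 1 → T x × ¬ T y
    ⟦⟧≡1⇒ {true} {false} _ = _ , id

    ⟦⟧≡1⇐ : ∀ {x y} → T x → ¬ T y → ⟦ x ∧ not y ⟧ ≡ 1
    ⟦⟧≡1⇐ {true} {true}  _ ¬y = contradiction _ ¬y
    ⟦⟧≡1⇐ {true} {false} _ ¬y = refl

    ⟦⟧≡0⇒ : ∀ {x y} → ⟦ x ∧ not y ⟧ ≡ 0 → T x → T y
    ⟦⟧≡0⇒ {true} {true} _ _ = _

    ⟦⟧≡0⇐ : ∀ {x y} → (T x → T y) → ⟦ x ∧ not y ⟧ ≡ 0
    ⟦⟧≡0⇐ {false}        _ = refl
    ⟦⟧≡0⇐ {true} {true}  _ = refl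
    ⟦⟧≡0⇐ {true} {false} h = contradiction (h _) id

    defects⇒ : IsTableau e → sum₃ defect ≡ 1 → SomeDefect
    defects⇒ T sum≡1 =
      let c₀ , a , b , here , others = sum₃≡1⇒ defect sum≡1
          asc , ¬rev = ⟦⟧≡1⇒ {ascends c₀ a b} {reverses c₀ a b} here
      in c₀ , a , b , record
        { c₀<n   = Fin.toℕ<n c₀
        ; here<  = ℕ.<ᵇ⇒< _ _ asc
        -- Not being reversed gives only ≤; the entries of a column, virtual or not, are distinct,
        -- which makes it strict.
        ; next<  = ℕ.≤∧≢⇒< (ℕ.≮⇒≥ (¬rev ∘ ℕ.<⇒<ᵇ)) λ eq →
            ℕ.<-irrefl (cong (λ r → e r (toℕ c₀)) (Tableau.column-injective T (Fin.toℕ<n c₀) eq))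
              (ℕ.<ᵇ⇒< _ _ asc)
        ; others = λ c<n → others′ others (at c<n)
        }
      where
      others′ : ∀ {c₀ : Fin n} {a b} → (∀ c r r′ → defect c r r′ ≡ 0 ⊎ (c ≡ c₀ × r ≡ a × r′ ≡ b)) →
                ∀ {c r r′} → ∃[ x ] toℕ {n} x ≡ c → e r c < e r′ c →
                e r′ (suc c) < e r (suc c) ⊎ (c ≡ toℕ c₀ × r ≡ a × r′ ≡ b)
      others′ others {r = r} {r′} (c , refl) lt with others c r r′
      ... | inj₁ eq           = inj₁ (ℕ.<ᵇ⇒< _ _ (⟦⟧≡0⇒ {ascends c r r′} {reverses c r r′} eq (ℕ.<⇒<ᵇ lt)))
      ... | inj₂ (refl , eqs) = inj₂ (refl , eqs)

    defects⇐ : SomeDefect → sum₃ defect ≡ 1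
    defects⇐ (c₀ , a , b , D) = sum₃≡1⇐ defect {c₀} {a} {b}
      (⟦⟧≡1⇐ {ascends c₀ a b} {reverses c₀ a b} (ℕ.<⇒<ᵇ here<) (ℕ.<-asym next< ∘ ℕ.<ᵇ⇒< _ _))
      rest
      where
      open SingleDefect D
      rest : ∀ c r r′ → defect c r r′ ≡ 0 ⊎ (c ≡ c₀ × r ≡ a × r′ ≡ b)
      rest c r r′ with e r (toℕ c) ℕ.<? e r′ (toℕ c)
      ... | no ≮ = inj₁ (⟦⟧≡0⇐ {ascends c r r′} {reverses c r r′} λ lt → contradiction (ℕ.<ᵇ⇒< _ _ lt) ≮)
      ... | yes lt with others (Fin.toℕ<n c) lt
      ...   | inj₁ inv          = inj₁ (⟦⟧≡0⇐ {ascends c r r′} {reverses c r r′} λ _ → ℕ.<⇒<ᵇ inv)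
      ...   | inj₂ (c≡c₀ , eqs) = inj₂ (Fin.toℕ-injective c≡c₀ , eqs)

    inS⇒ : T (inS m n (n * triangular (suc m′) ∸ 1) t) → Surjective t × IsTableau e × SomeDefect
    inS⇒ h =
      let tableau , h′ = to (T-∧ {isTableau t}) h
          rows , inv = to (T-∧ {isRowStandard t}) h′
          inj , surj = to (T-∧ {isInjective t}) tableau
          tab = extension-isTableau (entry t) (isInjective⇒ t inj) λ next →
            isRowStandard⇒ t rows (ℕ.≤-reflexive (sym next))
      in isSurjective⇒ t surj , tab , defects⇒ tab (inversions⇒defects tab (ℕ.≡ᵇ⇒≡ _ _ inv))

    inS⇐ : Surjective t → IsTableau e → SomeDefect → T (inS m n (n * triangular (suc m′) ∸ 1) t)
    inS⇐ surj tab D = from T-∧ (from T-∧ (isInjective⇐ t inj , isSurjective⇐ t surj) ,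
      from T-∧ (isRowStandard⇐ t rows , ℕ.≡⇒≡ᵇ _ _ (defects⇒inversions tab (defects⇐ D))))
      where
      inj : ∀ {r r′ c c′} → entry t r c ≡ entry t r′ c′ → r ≡ r′ × c ≡ c′
      inj {r} {r′} {c} {c′} eq
        with refl ← ExtensionTableau.pair-injective (entry t) tab {r} {c} {r′} {c′} eq = refl , refl
      rows : ∀ {r c c′} → c <ᶠ c′ → entry t r c <ᶠ entry t r c′
      rows {r} {c} {c′} lt = subst₂ _<_ (extension-toℕ (entry t) r c) (extension-toℕ (entry t) r c′)
        (Tableau.row-mono-< tab lt (ℕ.<⇒≤ (Fin.toℕ<n c′)))

  -- The bijection with the values of k

  module _ {e e′ : Fin m → ℕ → ℕ} (e≡e′ : ∀ r c → e r c ≡ e′ r c) where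

    IsTableau-resp : IsTableau e → IsTableau e′
    IsTableau-resp T = record
      { bounded    = λ c<n → subst (_< N) (e≡e′ _ _) (bounded c<n)
      ; injective  = λ c<n c′<n eq → injective c<n c′<n (trans (e≡e′ _ _) (trans eq (sym (e≡e′ _ _))))
      ; increasing = λ c<n → subst₂ _<_ (e≡e′ _ _) (e≡e′ _ _) (increasing c<n)
      ; final      = λ r → trans (sym (e≡e′ r _)) (final r)
      }
      where open IsTableau T

    SingleDefect-resp : ∀ {c₀ a b} → SingleDefect e c₀ a b → SingleDefect e′ c₀ a b
    SingleDefect-resp D = record
      { c₀<n   = c₀<n
      ; here<  = subst₂ _<_ (e≡e′ _ _) (e≡e′ _ _) here<
      ; next<  = subst₂ _<_ (e≡e′ _ _) (e≡e′ _ _) next<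
      ; others = λ c<n lt → Sum.map₁ (subst₂ _<_ (e≡e′ _ _) (e≡e′ _ _))
                   (others c<n (subst₂ _<_ (sym (e≡e′ _ _)) (sym (e≡e′ _ _)) lt))
      }
      where open SingleDefect D

  fill : (Fin m → Fin n → Fin N) → Filling m n
  fill f = Vec.tabulate (Vec.tabulate ∘ f)

  entry-fill : ∀ f r c → entry (fill f) r c ≡ f r c
  entry-fill f r c = trans (cong (λ row → lookup row c) (Vec.lookup∘tabulate (Vec.tabulate ∘ f) r))
                           (Vec.lookup∘tabulate (f r) c)

  fill-entry : ∀ f t → (∀ r c → f r c ≡ entry t r c) → fill f ≡ t
  fill-entry f t eq = trans (Vec.tabulate-cong λ r → trans (Vec.tabulate-cong (eq r))
                                                           (Vec.tabulate∘lookup (lookup t r)))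
                            (Vec.tabulate∘lookup t)

  -- k can be read as m c + j in one way only, and whether j is the top rank settles the kind; hence
  -- c, i and the exchange all depend on k alone.
  τ-irrelevant : ∀ {k c c′ i i′} (κ : Kind k c i) (κ′ : Kind k c′ i′) → ∀ r x → Model.τ κ r x ≡ Model.τ κ′ r x
  τ-irrelevant {c = c} {c′} {i} {i′} (regular eq) (regular eq′) r x
    with refl , i≡i′ ← val-injective {c} {c′} {inject₁ i} {inject₁ i′} (trans (sym eq) eq′)
    with refl ← Fin.inject₁-injective i≡i′ = refl
  τ-irrelevant {c = c} {c′} {i} {i′} (special refl eq) (special refl eq′) r x
    with refl , _ ← val-injective {c} {c′} {suc i} {suc i′} (trans (sym eq) eq′) = refl
  τ-irrelevant {c = c} {c′} {i} {i′} (regular eq) (special refl eq′) r x =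
    contradiction (sym (proj₂ (val-injective {c} {c′} {inject₁ i} {suc i′} (trans (sym eq) eq′)))) Fin.fromℕ≢inject₁
  τ-irrelevant {c = c} {c′} {i} {i′} (special refl eq) (regular eq′) r x =
    contradiction (proj₂ (val-injective {c} {c′} {suc i} {inject₁ i′} (trans (sym eq) eq′))) Fin.fromℕ≢inject₁

  -- The tableau determines its defect, and its entry at (b , c₀) is k + 1.
  τ-determines-k : ∀ {k k′ c c′ i i′} (κ : Kind k c i) (κ′ : Kind k′ c′ i′) →
                   (∀ r x → Model.τ κ r x ≡ Model.τ κ′ r x) → k ≡ k′
  τ-determines-k {k} {k′} {c} {c′} κ κ′ eq
    with c′≡c , _ , b′≡b ← defect-unique
           (SingleDefect-resp (extension-cong eq) (Model.τ-singleDefect κ)) (Model.τ-singleDefect κ′) =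
    Fin.toℕ-injective (ℕ.suc-injective (begin
      suc (toℕ k)                        ≡⟨ Model.e-b κ ⟨
      Model.e κ (Model.b κ) (toℕ c)      ≡⟨ extension-cong eq (Model.b κ) (toℕ c) ⟩
      Model.e κ′ (Model.b κ) (toℕ c)     ≡⟨ cong₂ (Model.e κ′) b′≡b c′≡c ⟨
      Model.e κ′ (Model.b κ′) (toℕ c′)   ≡⟨ Model.e-b κ′ ⟩
      suc (toℕ k′)                       ∎))
    where open ≡-Reasoning

  almostMaximal : ℕ
  almostMaximal = n * triangular (suc m′) ∸ 1

  abstract
    fill-inS : ∀ {k c i} (κ : Kind k c i) → T (inS m n almostMaximal (fill (Model.τ κ)))
    fill-inS {c = c} κ = inS⇐ t surjective (IsTableau-resp e≡ τ-isTableau)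
      (c , a , b , SingleDefect-resp e≡ τ-singleDefect)
      where
      open Model κ
      t : Filling m n
      t = fill τ
      e≡ : ∀ r c → extension τ r c ≡ extension (entry t) r c
      e≡ = extension-cong (λ r c → sym (entry-fill τ r c))
      surjective : Surjective t
      surjective v = let r , c , eq = τ-surjective v in r , c , trans (entry-fill τ r c) eq

    encode : (t : Filling m n) → T (inS m n almostMaximal t) →
             ∃[ k ] ∃[ c ] ∃[ i ] ∃ λ (κ : Kind k c i) → ∀ r x → entry t r x ≡ Model.τ κ r x
    encode t h =
      let surj , tab , c , _ , _ , D = inS⇒ t h
          k , i , κ , eq = reconstruct (entry t) surj tab D
      in k , c , i , κ , eq

  kind : ∀ k → Kind k (proj₁ (classify k)) (proj₁ (proj₂ (classify k)))
  kind k = proj₂ (proj₂ (classify k))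

  decode : Fin K → S m n almostMaximal
  decode k = fill (Model.τ (kind k)) , fill-inS (kind k)

  S↔Fin : S m n almostMaximal ↔ Fin K
  S↔Fin = mk↔ₛ′ (λ (t , h) → proj₁ (encode t h)) decode encode∘decode decode∘encode
    where
    encode∘decode : ∀ k → proj₁ (encode (proj₁ (decode k)) (proj₂ (decode k))) ≡ k
    encode∘decode k =
      let _ , _ , _ , κ , eq = encode (proj₁ (decode k)) (proj₂ (decode k))
      in τ-determines-k κ (kind k) λ r x → trans (sym (eq r x)) (entry-fill (Model.τ (kind k)) r x)

    S-≡ : ∀ {t t′ h h′} → t ≡ t′ → _≡_ {A = S m n almostMaximal} (t , h) (t′ , h′)
    S-≡ {t} {h = h} {h′} refl = cong (t ,_) (T-irrelevant h h′)

    decode∘encode : ∀ s → decode (proj₁ (encode (proj₁ s) (proj₂ s))) ≡ s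
    decode∘encode (t , h) =
      let k , _ , _ , κ , eq = encode t h
      in S-≡ (fill-entry (Model.τ (kind k)) t λ r x → trans (τ-irrelevant (kind k) κ r x) (sym (eq r x)))

theorem4p1 : (m n : ℕ) → 1 ≤ n → 2 ≤ m →
    S m n (n * triangular (m ∸ 1) ∸ 1) ↔ Fin (m * n ∸ 1)
theorem4p1 (suc (suc m′)) (suc n′) (s≤s z≤n) (s≤s (s≤s z≤n)) = Rectangle.S↔Fin m′ n′
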